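{- For every integer $d\ge 0$, the following identities hold: (1) $E^+_d = \sum_{\delta = \alpha^1(b)^2 \in \mathrm{PCom}_E(d)} (-1)^{\ell(\alpha)} E_{\delta}$; (2) $E^+_d = \sum_{\delta = (a)^1\beta^2 \in \mathrm{PCom}_H(d)} (-1)^{\ell(\beta)} H_{\delta}$; (3) $E^+_d = \sum_{\delta = \alpha^1 \beta^2 \in \mathrm{PCom}_P(d)} (-1)^{\ell(\beta)} \dfrac{1}{Z_\alpha Z_\beta}P_{\delta}$.
   Context: A composition of $n\ge 0$ is a finite tuple $\alpha=(\alpha_1,\dots,\alpha_l)$ of positive integers with sum $|\alpha|=n$; $\ell(\alpha)=l$; the empty composition is the only composition of $0$. A polycomposition of $n$ is a sequence $\delta=(\alpha^{(1)},\alpha^{(2)},\dots)$ of (possibly empty) compositions with $\sum_{i\ge1} i|\alpha^{(i)}|=n$; write formally (not exponentiation) $\delta=(\alpha^{(1)})^1(\alpha^{(2)})^2\cdots$, omitting empty compositions. Each part $d$ of $\alpha^{(r)}$ gives a block $d^r$ of $\delta$. $\mathrm{PCom}_P(d)$ is the set of polycompositions of $d$ of the form $\alpha^1\beta^2$ with $\alpha,\beta$ (possibly empty) compositions (so $|\alpha|+2|\beta|=d$). $\mathrm{PCom}_E(d)$ is the set of polycompositions of $d$ of the form $\alpha^1(b)^2$ with $\alpha$ a (possibly empty) composition and $b$ a non-negative integer. $\mathrm{PCom}_H(d)$ is the set of polycompositions of $d$ of the form $(a)^1\beta^2$ with $\beta$ a (possibly empty) composition and $a$ a non-negative integer. In the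 last two, $b=0$ (resp. $a=0$) means the corresponding composition is empty. For a composition $\alpha=(\alpha_1,\dots,\alpha_l)$ put $Z_\alpha=\alpha_1(\alpha_1+\alpha_2)\cdots(\alpha_1+\cdots+\alpha_l)$, equal to $1$ for the empty composition. Let $x_{i,j}$ ($i,j\ge 1$) be indeterminates with $\deg x_{i,j}=i$; all series have rational coefficients. A monomial is square-free if every exponent is at most $1$. For $d\ge 0$: $H_d$ is the sum of all monomials of degree $d$; $E^+_d$ is the sum of all square-free monomials of degree $d$; $E_d$ is the sum over square-free monomials $f$ of degree $d$ of $(-1)^{m(f)}f$, where $m(f)$ is the number of indeterminates in $f$; for $d\ge 1$, $P_d=\sum_{k\mid d}\sum_{j\ge1} k\,x_{k,j}^{d/k}$. For $F\in\{H,E,P\}$ and a block $d^r$, $F_{d^r}$ is obtained from $F_d$ by replacing each $x_{i,j}$ by $x_{i,j}^r$, and $F_\delta=\prod F_{d^r}$ over all blocks $d^r$ of $\delta$ (counted with repetition; empty product $=1$). -}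

module Defs where

open import Data.Bool.Base using (if_then_else_)
open import Data.Integer.Base as ℤ using ()
open import Data.List.Base
  using (List; []; _∷_; [_]; _++_; map; concatMap; foldr; filter; length; replicate;
         upTo; cartesianProduct; cartesianProductWith)
open import Data.Nat.Base using (ℕ; zero; suc; _+_; _*_; _∸_; _⊓_; _≤_; _<_; NonZero; z≤n; s≤s⁻¹; ≢-nonZero; ≢-nonZero⁻¹)
open import Data.Nat.DivMod using (_/_; 0/n≡0)
open import Data.Nat.Divisibility using (_∣_; _∣?_; _∣0)
open import Data.Nat.ListAction using (sum)
open import Data.Nat.Properties
  using (_≟_; _≤?_; _<?_; ≮⇒≥; m*n≢0; m+n≡0⇒n≡0; anyUpTo?; *-zeroʳ)
open import Data.Product.Base using (_×_; _,_; ∃; uncurry)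
open import Data.Rational.Base as ℚ using (ℚ; 0ℚ; 1ℚ)
import Data.Rational.Properties as ℚ
open import Function.Base using (_∘_; const)
open import Function.Bundles using (Func; mk⇔)
import Function.Relation.Binary.Setoid.Equality as FuncEquality
open import Level using (0ℓ)
open import Relation.Binary.Bundles using (Setoid)
open import Relation.Binary.Core using (Rel)
open import Relation.Binary.Definitions
  using (Reflexive; Symmetric; _Respects_) renaming (Decidable to Decidable₂)
open import Relation.Binary.PropositionalEquality
  using (_≡_; refl; sym; trans; cong; cong₂; subst; setoid; module ≡-Reasoning)
open import Relation.Nullary.Decidable using (Dec; yes; no; does; map′; _×-dec_; does-⇔)
open import Relation.Nullary.Negation using (contradiction)
open import Relation.Unary using (Pred; Decidable)

-- A list denotes the sequence obtained by continuing it with z forever.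

module _ {A : Set} (z : A) where

  at : List A → ℕ → A
  at []       _       = z
  at (x ∷ _)  zero    = x
  at (_ ∷ xs) (suc n) = at xs n

  single : ℕ → A → List A
  single n x = replicate n z ++ [ x ]

  at-single : ∀ n x → at (single n x) n ≡ x
  at-single zero    x = refl
  at-single (suc n) x = at-single n x

  at-beyond : ∀ xs n → length xs ≤ n → at xs n ≡ z
  at-beyond []       n       _ = refl
  at-beyond (x ∷ xs) (suc n) p = at-beyond xs n (s≤s⁻¹ p)

  all-at? : ∀ {P : Pred A 0ℓ} → Decidable P → P z → ∀ xs → Dec (∀ n → P (at xs n))
  all-at? P? pz []       = yes (λ _ → pz)
  all-at? P? pz (x ∷ xs) =
    map′ (λ { (p , _) zero → p ; (_ , ps) (suc n) → ps n })
         (λ ps → ps zero , ps ∘ suc)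
         (P? x ×-dec all-at? P? pz xs)

at-map : ∀ {A B : Set} (f : A → B) z xs n → at (f z) (map f xs) n ≡ f (at z xs n)
at-map f z []       _       = refl
at-map f z (x ∷ xs) zero    = refl
at-map f z (x ∷ xs) (suc n) = at-map f z xs n

module Padded {A : Set} (_~_ : Rel A 0ℓ) (~-refl : Reflexive _~_) (z : A) where

  infix 4 _≋_

  _≋_ : Rel (List A) 0ℓ
  xs ≋ ys = ∀ n → at z xs n ~ at z ys n

  single-≋[] : ∀ n {x} → x ~ z → single z n x ≋ []
  single-≋[] zero    x~z zero    = x~z
  single-≋[] zero    x~z (suc k) = ~-refl
  single-≋[] (suc n) x~z zero    = ~-refl
  single-≋[] (suc n) x~z (suc k) = single-≋[] n x~z k

  ≋-dec : Decidable₂ _~_ → Decidable₂ _≋_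
  ≋-dec _~?_ []       []       = yes (λ _ → ~-refl)
  ≋-dec _~?_ []       (y ∷ ys) =
    map′ (λ { (p , _) zero → p ; (_ , ps) (suc n) → ps n })
         (λ ps → ps zero , ps ∘ suc)
         ((z ~? y) ×-dec ≋-dec _~?_ [] ys)
  ≋-dec _~?_ (x ∷ xs) []       =
    map′ (λ { (p , _) zero → p ; (_ , ps) (suc n) → ps n })
         (λ ps → ps zero , ps ∘ suc)
         ((x ~? z) ×-dec ≋-dec _~?_ xs [])
  ≋-dec _~?_ (x ∷ xs) (y ∷ ys) =
    map′ (λ { (p , _) zero → p ; (_ , ps) (suc n) → ps n })
         (λ ps → ps zero , ps ∘ suc)
         ((x ~? y) ×-dec ≋-dec _~?_ xs ys)

-- sumAt f [x₀, x₁, …] = f 0 x₀ + f 1 x₁ + ⋯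

sumAt : ∀ {A : Set} → (ℕ → A → ℕ) → List A → ℕ
sumAt f []       = 0
sumAt f (x ∷ xs) = f 0 x + sumAt (f ∘ suc) xs

module _ {A : Set} (_~_ : Rel A 0ℓ) (~-refl : Reflexive _~_) (z : A) where
  open Padded _~_ ~-refl z

  sumAt-cong : ∀ f → (∀ n → f n z ≡ 0) → (∀ n x y → x ~ y → f n x ≡ f n y) →
               ∀ xs ys → xs ≋ ys → sumAt f xs ≡ sumAt f ys
  sumAt-cong f fz fc []       []       e = refl
  sumAt-cong f fz fc []       (y ∷ ys) e =
    cong₂ _+_ (trans (sym (fz 0)) (fc 0 _ _ (e 0)))
              (sumAt-cong (f ∘ suc) (fz ∘ suc) (fc ∘ suc) [] ys (e ∘ suc))
  sumAt-cong f fz fc (x ∷ xs) []       e =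
    cong₂ _+_ (trans (fc 0 _ _ (e 0)) (fz 0))
              (sumAt-cong (f ∘ suc) (fz ∘ suc) (fc ∘ suc) xs [] (e ∘ suc))
  sumAt-cong f fz fc (x ∷ xs) (y ∷ ys) e =
    cong₂ _+_ (fc 0 _ _ (e 0))
              (sumAt-cong (f ∘ suc) (fz ∘ suc) (fc ∘ suc) xs ys (e ∘ suc))

-- A monomial in the x_{i,j}, i, j ≥ 1, is given by its matrix of exponents:
-- entry j of row i (counting from 0) is the exponent of x_{i+1,j+1}, and
-- missing entries are 0.  Different lists may thus denote the same
-- monomial, whence the equivalence _≈ᵐ_.

Monomial : Set
Monomial = List (List ℕ)

exponent : Monomial → ℕ → ℕ → ℕ
exponent m i j = at 0 (at [] m i) j

private
  module Row  = Padded {ℕ} _≡_ refl 0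
  module Rows = Padded Row._≋_ (λ {r} j → refl) []

infix 4 _≈ᵐ_ _≈ᵐ?_

_≈ᵐ_ : Rel Monomial 0ℓ
m ≈ᵐ n = ∀ i j → exponent m i j ≡ exponent n i j

_≈ᵐ?_ : Decidable₂ _≈ᵐ_
_≈ᵐ?_ = Rows.≋-dec (Row.≋-dec _≟_)

monomials : Setoid 0ℓ 0ℓ
monomials = record
  { Carrier       = Monomial
  ; _≈_           = _≈ᵐ_
  ; isEquivalence = record
    { refl  = λ i j → refl
    ; sym   = λ p i j → sym (p i j)
    ; trans = λ p q i j → trans (p i j) (q i j)
    }
  }

open Setoid monomials using () renaming (refl to ≈ᵐ-refl; sym to ≈ᵐ-sym; trans to ≈ᵐ-trans)

-- power i j e = x_{i+1,j+1}^e

power : ℕ → ℕ → ℕ → Monomial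
power i j e = single [] i (single 0 j e)

sumVars : (ℕ → ℕ → ℕ → ℕ) → Monomial → ℕ
sumVars f = sumAt (λ i → sumAt (f i))

degree : Monomial → ℕ
degree = sumVars (λ i j e → suc i * e)

-- 1 ⊓ e is 1 if e is positive and 0 otherwise.

#indeterminates : Monomial → ℕ
#indeterminates = sumVars (λ i j e → 1 ⊓ e)

SquareFree : Pred Monomial 0ℓ
SquareFree m = ∀ i j → exponent m i j ≤ 1

HasDegree : ℕ → Pred Monomial 0ℓ
HasDegree d m = degree m ≡ d

SquareFreeOfDegree : ℕ → Pred Monomial 0ℓ
SquareFreeOfDegree d m = SquareFree m × HasDegree d m

PowerInRow : ℕ → ℕ → Pred Monomial 0ℓ
PowerInRow i e m = ∃ λ j → m ≈ᵐ power i j e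

sumVars-cong : ∀ f → (∀ i j → f i j 0 ≡ 0) → ∀ {m n} → m ≈ᵐ n → sumVars f m ≡ sumVars f n
sumVars-cong f f0 {m} {n} =
  sumAt-cong Row._≋_ (λ {r} j → refl) [] (λ i → sumAt (f i)) (λ i → refl)
    (λ i → sumAt-cong _≡_ refl 0 (f i) (f0 i) (λ { j x y refl → refl })) m n

degree-cong : ∀ {m n} → m ≈ᵐ n → degree m ≡ degree n
degree-cong {m} {n} = sumVars-cong _ (λ i j → *-zeroʳ (suc i)) {m} {n}

#indeterminates-cong : ∀ {m n} → m ≈ᵐ n → #indeterminates m ≡ #indeterminates n
#indeterminates-cong {m} {n} = sumVars-cong _ (λ i j → refl) {m} {n}

hasDegree? : ∀ d → Decidable (HasDegree d)
hasDegree? d m = degree m ≟ d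

squareFreeOfDegree? : ∀ d → Decidable (SquareFreeOfDegree d)
squareFreeOfDegree? d m =
  all-at? [] (all-at? 0 (_≤? 1) z≤n) (λ j → z≤n) m ×-dec hasDegree? d m

powerInRow? : ∀ i e → Decidable (PowerInRow i e)
powerInRow? i zero m =
  map′ (λ p → 0 , ≈ᵐ-trans {m} {[]} {power i 0 0} p (≈ᵐ-sym {power i 0 0} {[]} (trivial 0)))
       (λ { (j , p) → ≈ᵐ-trans {m} {power i j 0} {[]} p (trivial j) })
       (m ≈ᵐ? [])
  where
  trivial : ∀ j → power i j 0 ≈ᵐ []
  trivial j = Rows.single-≋[] i (Row.single-≋[] j refl)
powerInRow? i e@(suc _) m =
  map′ (λ { (j , _ , p) → j , p })
       (λ { (j , p) → j , bound j p , p })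
       (anyUpTo? (λ j → m ≈ᵐ? power i j e) (length (at [] m i)))
  where
  bound : ∀ j → m ≈ᵐ power i j e → j < length (at [] m i)
  bound j p with j <? length (at [] m i)
  ... | yes j<l = j<l
  ... | no  j≮l = contradiction
    (begin
      0                        ≡⟨ sym (at-beyond 0 (at [] m i) j (≮⇒≥ j≮l)) ⟩
      exponent m i j           ≡⟨ p i j ⟩
      exponent (power i j e) i j ≡⟨ cong (λ r → at 0 r j) (at-single [] i _) ⟩
      at 0 (single 0 j e) j    ≡⟨ at-single 0 j e ⟩
      e                        ∎)
    (λ ())
    where open ≡-Reasoning

hasDegree-resp : ∀ d → HasDegree d Respects _≈ᵐ_
hasDegree-resp d {m} {n} p = trans (sym (degree-cong {m} {n} p))

squareFreeOfDegree-resp : ∀ d → SquareFreeOfDegree d Respects _≈ᵐ_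
squareFreeOfDegree-resp d {m} {n} p (sf , dg) =
  (λ i j → subst (_≤ 1) (p i j) (sf i j)) , hasDegree-resp d {m} {n} p dg

powerInRow-resp : ∀ i e → PowerInRow i e Respects _≈ᵐ_
powerInRow-resp i e {m} {n} p (j , q) =
  j , ≈ᵐ-trans {n} {m} {power i j e} (≈ᵐ-sym {m} {n} p) q

Series : Set
Series = Func monomials (setoid ℚ)

open Func public using () renaming (to to coeff; cong to coeff-cong)
open FuncEquality monomials (setoid ℚ) public using (_≈_)

sumℚ : List ℚ → ℚ
sumℚ = foldr ℚ._+_ 0ℚ

-- The sum of w(f) f over all monomials f satisfying P.

sumOver : ∀ {P : Pred Monomial 0ℓ} → Decidable P → P Respects _≈ᵐ_ →
          (w : Monomial → ℚ) → (∀ {m n} → m ≈ᵐ n → w m ≡ w n) → Series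
sumOver P? resp w w-cong = record
  { to   = λ m → if does (P? m) then w m else 0ℚ
  ; cong = λ {m} {n} p → cong₂ (λ b q → if b then q else 0ℚ)
      (does-⇔ (mk⇔ (resp {m} {n} p) (resp {n} {m} (≈ᵐ-sym {m} {n} p))) (P? m) (P? n))
      (w-cong {m} {n} p)
  }

1ₛ : Series
1ₛ = sumOver (_≈ᵐ? []) (λ {m} {n} p q → ≈ᵐ-trans {n} {m} {[]} (≈ᵐ-sym {m} {n} p) q)
       (const 1ℚ) (λ _ → refl)

infixr 7 _•_
infixl 7 _*ₛ_

_•_ : ℚ → Series → Series
q • F = record
  { to   = λ m → q ℚ.* coeff F m
  ; cong = λ {m} {n} p → cong (q ℚ.*_) (coeff-cong F {m} {n} p)
  }

∑ : ∀ {A : Set} → List A → (A → Series) → Series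
∑ xs F = record
  { to   = λ m → sumℚ (map (λ x → coeff (F x) m) xs)
  ; cong = λ {m} {n} p → go {m} {n} p xs
  }
  where
  go : ∀ {m n} → m ≈ᵐ n → ∀ xs →
       sumℚ (map (λ x → coeff (F x) m) xs) ≡ sumℚ (map (λ x → coeff (F x) n) xs)
  go         p []       = refl
  go {m} {n} p (x ∷ xs) = cong₂ ℚ._+_ (coeff-cong (F x) {m} {n} p) (go {m} {n} p xs)

syntax ∑ xs (λ x → F) = ∑[ x ∈ xs ] F

-- splittings m lists the pairs of monomials with product m, each once.

splittingsℕ : ℕ → List (ℕ × ℕ)
splittingsℕ n = map (λ i → i , n ∸ i) (upTo (suc n))

splittingsList : ∀ {A : Set} → (A → List (A × A)) → List A → List (List A × List A)
splittingsList s []       = [ [] , [] ]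
splittingsList s (x ∷ xs) =
  cartesianProductWith (λ (a , b) (as , bs) → a ∷ as , b ∷ bs) (s x) (splittingsList s xs)

splittings : Monomial → List (Monomial × Monomial)
splittings = splittingsList (splittingsList splittingsℕ)

sumPairs : ∀ {A : Set} → (A → A → ℚ) → List (A × A) → ℚ
sumPairs f ps = sumℚ (map (uncurry f) ps)

-- The sum over splittings does not depend on the list denoting a monomial.

private
  Respecting : ∀ {A : Set} → Rel A 0ℓ → (A → A → ℚ) → Set
  Respecting _~_ f = ∀ a a′ b b′ → a ~ a′ → b ~ b′ → f a b ≡ f a′ b′

  SplitInvariant : ∀ {A : Set} → Rel A 0ℓ → (A → List (A × A)) → Set
  SplitInvariant _~_ s = ∀ f → Respecting _~_ f → ∀ x y → x ~ y →
                         sumPairs f (s x) ≡ sumPairs f (s y)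

  sumPairs-++ : ∀ {A : Set} (f : A → A → ℚ) ps qs →
                sumPairs f (ps ++ qs) ≡ sumPairs f ps ℚ.+ sumPairs f qs
  sumPairs-++ f []       qs = sym (ℚ.+-identityˡ _)
  sumPairs-++ f (p ∷ ps) qs = trans (cong (uncurry f p ℚ.+_) (sumPairs-++ f ps qs))
                                    (sym (ℚ.+-assoc (uncurry f p) _ _))

  sumPairs-cong : ∀ {A : Set} {f g : A → A → ℚ} → (∀ a b → f a b ≡ g a b) →
                  ∀ ps → sumPairs f ps ≡ sumPairs g ps
  sumPairs-cong e []             = refl
  sumPairs-cong e ((a , b) ∷ ps) = cong₂ ℚ._+_ (e a b) (sumPairs-cong e ps)

  module _ {A : Set} where

    consPair : A × A → List A × List A → List A × List A
    consPair (a , b) (as , bs) = a ∷ as , b ∷ bs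

    inner : (List A → List A → ℚ) → List (List A × List A) → A → A → ℚ
    inner f qs a b = sumPairs (λ as bs → f (a ∷ as) (b ∷ bs)) qs

    sum-consPair : ∀ f a b (qs : List (List A × List A)) →
                   sumPairs f (map (consPair (a , b)) qs) ≡ inner f qs a b
    sum-consPair f a b []               = refl
    sum-consPair f a b ((as , bs) ∷ qs) =
      cong (f (a ∷ as) (b ∷ bs) ℚ.+_) (sum-consPair f a b qs)

    sum-product : ∀ f (ps : List (A × A)) qs →
                  sumPairs f (cartesianProductWith consPair ps qs) ≡ sumPairs (inner f qs) ps
    sum-product f []             qs = refl
    sum-product f ((a , b) ∷ ps) qs =
      trans (sumPairs-++ f (map (consPair (a , b)) qs) _)
            (cong₂ ℚ._+_ (sum-consPair f a b qs) (sum-product f ps qs))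

  module _ {A : Set} (_~_ : Rel A 0ℓ) (~-refl : Reflexive _~_) (~-sym : Symmetric _~_) (z : A)
           (s : A → List (A × A)) (s-z : s z ≡ [ z , z ]) (s-inv : SplitInvariant _~_ s) where
    open Padded _~_ ~-refl z

    cons-cong : ∀ {x y xs ys} → x ~ y → xs ≋ ys → (x ∷ xs) ≋ (y ∷ ys)
    cons-cong p ps zero    = p
    cons-cong p ps (suc n) = ps n

    head-resp : ∀ f → Respecting _≋_ f → ∀ qs → Respecting _~_ (inner f qs)
    head-resp f fr qs a a′ b b′ p q = sumPairs-cong
      (λ as bs → fr (a ∷ as) (a′ ∷ as) (b ∷ bs) (b′ ∷ bs)
        (cons-cong {a} {a′} {as} {as} p (λ _ → ~-refl))
        (cons-cong {b} {b′} {bs} {bs} q (λ _ → ~-refl))) qs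

    tail-resp : ∀ f → Respecting _≋_ f →
                ∀ a b → Respecting _≋_ (λ as bs → f (a ∷ as) (b ∷ bs))
    tail-resp f fr a b as as′ bs bs′ p q =
      fr (a ∷ as) (a ∷ as′) (b ∷ bs) (b ∷ bs′)
        (cons-cong {a} {a} {as} {as′} ~-refl p) (cons-cong {b} {b} {bs} {bs′} ~-refl q)

    []≋z∷[] : [] ≋ (z ∷ [])
    []≋z∷[] zero    = ~-refl
    []≋z∷[] (suc n) = ~-refl

    splittingsList-inv : SplitInvariant _≋_ (splittingsList s)

    prepend : ∀ f → Respecting _≋_ f → ∀ y ys → [] ≋ (y ∷ ys) →
              sumPairs f (splittingsList s []) ≡ sumPairs f (splittingsList s (y ∷ ys))
    prepend f fr y ys e = begin
      sumPairs f [ [] , [] ]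
        ≡⟨ cong (ℚ._+ 0ℚ) (fr [] (z ∷ []) [] (z ∷ []) []≋z∷[] []≋z∷[]) ⟩
      inner f (splittingsList s []) z z
        ≡⟨ splittingsList-inv _ (tail-resp f fr z z) [] ys (e ∘ suc) ⟩
      inner f (splittingsList s ys) z z
        ≡⟨ sym (ℚ.+-identityʳ _) ⟩
      sumPairs (inner f (splittingsList s ys)) [ z , z ]
        ≡⟨ cong (sumPairs _) (sym s-z) ⟩
      sumPairs (inner f (splittingsList s ys)) (s z)
        ≡⟨ s-inv _ (head-resp f fr (splittingsList s ys)) z y (e zero) ⟩
      sumPairs (inner f (splittingsList s ys)) (s y)
        ≡⟨ sym (sum-product f (s y) (splittingsList s ys)) ⟩
      sumPairs f (splittingsList s (y ∷ ys)) ∎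
      where open ≡-Reasoning

    splittingsList-inv f fr []       []       e = refl
    splittingsList-inv f fr []       (y ∷ ys) e = prepend f fr y ys e
    splittingsList-inv f fr (x ∷ xs) []       e = sym (prepend f fr x xs (λ n → ~-sym (e n)))
    splittingsList-inv f fr (x ∷ xs) (y ∷ ys) e = begin
      sumPairs f (splittingsList s (x ∷ xs))
        ≡⟨ sum-product f (s x) (splittingsList s xs) ⟩
      sumPairs (inner f (splittingsList s xs)) (s x)
        ≡⟨ sumPairs-cong
             (λ a b → splittingsList-inv _ (tail-resp f fr a b) xs ys (e ∘ suc)) (s x) ⟩
      sumPairs (inner f (splittingsList s ys)) (s x)
        ≡⟨ s-inv _ (head-resp f fr (splittingsList s ys)) x y (e zero) ⟩
      sumPairs (inner f (splittingsList s ys)) (s y)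
        ≡⟨ sym (sum-product f (s y) (splittingsList s ys)) ⟩
      sumPairs f (splittingsList s (y ∷ ys)) ∎
      where open ≡-Reasoning

  splittings-inv : SplitInvariant _≈ᵐ_ splittings
  splittings-inv =
    splittingsList-inv Row._≋_ (λ {r} j → refl) (λ p j → sym (p j)) [] (splittingsList splittingsℕ) refl
      (splittingsList-inv _≡_ refl sym 0 splittingsℕ refl (λ { f fr x y refl → refl }))

_*ₛ_ : Series → Series → Series
F *ₛ G = record
  { to   = λ m → sumPairs (λ a b → coeff F a ℚ.* coeff G b) (splittings m)
  ; cong = λ {m} {n} → splittings-inv _
      (λ a a′ b b′ p q → cong₂ ℚ._*_ (coeff-cong F {a} {a′} p) (coeff-cong G {b} {b′} q)) m n
  }

productₛ : List Series → Series
productₛ = foldr _*ₛ_ 1ₛ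

-- dilate r F is F with each x_{i,j} replaced by x_{i,j}^r: its coefficient
-- at f^r is that of F at f, and 0 at monomials which are not r-th powers.

module _ (r : ℕ) .{{_ : NonZero r}} where

  IsPower : Pred Monomial 0ℓ
  IsPower m = ∀ i j → r ∣ exponent m i j

  isPower? : Decidable IsPower
  isPower? = all-at? [] (all-at? 0 (r ∣?_) (r ∣0)) (λ j → r ∣0)

  root : Monomial → Monomial
  root = map (map (_/ r))

  root-cong : ∀ {m n} → m ≈ᵐ n → root m ≈ᵐ root n
  root-cong {m} {n} p i j = begin
    exponent (root m) i j ≡⟨ lemma m ⟩
    exponent m i j / r    ≡⟨ cong (_/ r) (p i j) ⟩
    exponent n i j / r    ≡⟨ sym (lemma n) ⟩
    exponent (root n) i j ∎
    where
    open ≡-Reasoning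
    0/r : 0 / r ≡ 0
    0/r = 0/n≡0 r
    lemma : ∀ m → exponent (root m) i j ≡ exponent m i j / r
    lemma m = begin
      at 0 (at [] (root m) i) j             ≡⟨ cong (λ q → at 0 q j) (at-map (map (_/ r)) [] m i) ⟩
      at 0 (map (_/ r) (at [] m i)) j       ≡⟨ cong (λ q → at q (map (_/ r) (at [] m i)) j) (sym 0/r) ⟩
      at (0 / r) (map (_/ r) (at [] m i)) j ≡⟨ at-map (_/ r) 0 (at [] m i) j ⟩
      exponent m i j / r                    ∎

  dilate : Series → Series
  dilate F = sumOver isPower? (λ p h i j → subst (r ∣_) (p i j) (h i j))
    (λ m → coeff F (root m))
    (λ {m} {n} p → coeff-cong F {root m} {root n} (root-cong {m} {n} p))

infix 8 -1^_

-1^_ : ℕ → ℚ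
-1^ zero  = 1ℚ
-1^ suc n = ℚ.- (-1^ n)

fromℕ : ℕ → ℚ
fromℕ n = ℤ.+ n ℚ./ 1

H : ℕ → Series
H d = sumOver (hasDegree? d) (λ {m} {n} → hasDegree-resp d {m} {n}) (const 1ℚ) (λ _ → refl)

E⁺ : ℕ → Series
E⁺ d = sumOver (squareFreeOfDegree? d) (λ {m} {n} → squareFreeOfDegree-resp d {m} {n})
         (const 1ℚ) (λ _ → refl)

E : ℕ → Series
E d = sumOver (squareFreeOfDegree? d) (λ {m} {n} → squareFreeOfDegree-resp d {m} {n})
        (λ m → -1^ #indeterminates m)
        (λ {m} {n} p → cong -1^_ (#indeterminates-cong {m} {n} p))

-- powerSum i e = ∑_{j≥1} x_{i+1,j}^e, for e ≥ 1 (so that the monomials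
-- x_{i+1,j}^e are distinct)

powerSum : ℕ → ℕ → Series
powerSum i e = sumOver (powerInRow? i e) (λ {m} {n} → powerInRow-resp i e {m} {n})
                 (const 1ℚ) (λ _ → refl)

-- Only meaningful for d ≥ 1; in the sum, k = i + 1.

P : ℕ → Series
P d = ∑[ i ∈ filter (λ i → suc i ∣? d) (upTo d) ] (fromℕ (suc i) • powerSum i (d / suc i))

record ℕ⁺ : Set where
  constructor pos
  field
    value        : ℕ
    .{{nonZero}} : NonZero value

open ℕ⁺ public

Composition : Set
Composition = List ℕ⁺

∣_∣ : Composition → ℕ
∣ α ∣ = sum (map value α)

ℓ : Composition → ℕ
ℓ = length

-- Z-from s α = (s + α₁)(s + α₁ + α₂)⋯(s + α₁ + ⋯ + α_l)

Z-from : ℕ → Composition → ℕ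
Z-from s []      = 1
Z-from s (k ∷ α) = (s + value k) * Z-from (s + value k) α

Z : Composition → ℕ
Z = Z-from 0

Z-from-nonZero : ∀ s α → NonZero (Z-from s α)
Z-from-nonZero s []          = _
Z-from-nonZero s (pos k ∷ α) =
  m*n≢0 (s + k) _ {{≢-nonZero (≢-nonZero⁻¹ k ∘ m+n≡0⇒n≡0 s)}} {{Z-from-nonZero (s + k) α}}

1/Z : Composition → ℚ
1/Z α = ℚ._/_ (ℤ.+ 1) (Z α) {{Z-from-nonZero 0 α}}

compositionsOfLength : ℕ → ℕ → List Composition
compositionsOfLength zero    zero    = [ [] ]
compositionsOfLength zero    (suc n) = []
compositionsOfLength (suc l) n       =
  concatMap (λ i → map (pos (suc i) ∷_) (compositionsOfLength l (n ∸ suc i))) (upTo n)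

compositions : ℕ → List Composition
compositions n = concatMap (λ l → compositionsOfLength l n) (upTo (suc n))

-- The composition (n), which for n = 0 is the empty one.

row : ℕ → Composition
row zero    = []
row (suc n) = [ pos (suc n) ]

-- α^(1) ∷ α^(2) ∷ ⋯ ∷ [] is (α^(1))^1 (α^(2))^2 ⋯.

Polycomposition : Set
Polycomposition = List Composition

size : Polycomposition → ℕ
size = sumAt (λ i α → suc i * ∣ α ∣)

_¹_² : Composition → Composition → Polycomposition
α ¹ β ² = α ∷ β ∷ []

-- The block d^r is the pair (d , r).  In blocksFrom i, the list starts at
-- α^(i+1).

blocksFrom : ℕ → Polycomposition → List (ℕ⁺ × ℕ⁺)
blocksFrom i []      = []
blocksFrom i (α ∷ δ) = map (_, pos (suc i)) α ++ blocksFrom (suc i) δ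

blocks : Polycomposition → List (ℕ⁺ × ℕ⁺)
blocks = blocksFrom 0

infix 9 _⟦_⟧

_⟦_⟧ : (ℕ → Series) → Polycomposition → Series
F ⟦ δ ⟧ = productₛ (map (λ (d , r) → dilate (value r) (F (value d))) (blocks δ))

-- The polycompositions α ¹ β ² of d, given as the pairs (α , β), with α
-- in A n and β in B n′ for some n, n′.  When A n and B n′ list compositions
-- of n and n′, only n, n′ ≤ d can contribute.

pairsOfSize : (A B : ℕ → List Composition) → ℕ → List (Composition × Composition)
pairsOfSize A B d =
  filter (λ (α , β) → size (α ¹ β ²) ≟ d)
         (cartesianProduct (concatMap A (upTo (suc d))) (concatMap B (upTo (suc d))))

PComP : ℕ → List (Composition × Composition)
PComP = pairsOfSize compositions compositions

PComE : ℕ → List (Composition × Composition)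
PComE = pairsOfSize compositions ([_] ∘ row)

PComH : ℕ → List (Composition × Composition)
PComH = pairsOfSize ([_] ∘ row) compositions

{-# OPTIONS --safe #-}
module Submission where

-- Put H = ∑ H_d, E = ∑ E_d, E⁺ = ∑ E⁺_d and P = ∑ P_d.  Coefficientwise, H, E and
-- E⁺ are multiplicative over the indeterminates, being the products of 1/(1 - x),
-- 1 - x and 1 + x over all indeterminates x, while P is supported on powers of a
-- single indeterminate.  Arithmetic in one variable thus gives EH = 1, the identity
-- E⁺ = H · E(x²), and the logarithmic derivatives D H = P H and D E = - P E, where D
-- multiplies a monomial by its degree.  Splitting off the first part of a composition
-- inverts E and H (the sums with signs) and integrates the logarithmic derivatives
-- (the sums with weights 1/Z).  As everything is homogeneous, the condition on the
-- size of a polycomposition amounts to one on the degree of the monomial.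

open import Defs
open import Algebra.Bundles using (CommutativeMonoid)
import Algebra.Properties.CommutativeSemigroup as CommSemigroup
open import Data.Bool.Base using (Bool; true; false; if_then_else_; _∧_)
open import Data.Integer.Base as ℤ using ()
import Data.Integer.Properties as ℤ
open import Data.List.Base
  using (List; []; _∷_; [_]; _++_; map; concatMap; filter; upTo; applyUpTo;
         cartesianProduct; cartesianProductWith)
open import Data.List.Properties using (map-upTo; map-cong; map-id)
open import Data.Nat.Base as ℕ using (ℕ; zero; suc; _≤_; _<_; z≤n; s≤s)
open import Data.Nat.DivMod using (_/_; m/n≡1+[m∸n]/n; m*n/n≡m; m*[n/m]≡n; n/1≡n)
open import Data.Nat.Divisibility
  using (_∣_; _∣?_; 1∣_; ∣m+n∣m⇒∣n; ∣m∣n⇒∣m+n; ∣-refl; m∣m*n)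
open import Data.Nat.Properties as ℕ using (_≟_)
open import Data.Product.Base using (_×_; _,_; ∃; ∃₂; uncurry; proj₁; proj₂)
open import Data.Rational.Base using () renaming (_*_ to _*ℚ_)
open import Data.Rational.Base as ℚ using (ℚ; 0ℚ; 1ℚ; _+_; _*_; -_; toℚᵘ)
open import Data.Rational.Properties as ℚ
  using (+-identityˡ; +-identityʳ; +-assoc; *-assoc; *-comm; *-zeroˡ; *-zeroʳ;
         *-identityˡ; *-identityʳ; *-distribˡ-+; *-distribʳ-+; +-*-commutativeRing)
open import Data.Rational.Unnormalised.Base as ℚᵘ using (mkℚᵘ; *≡*)
import Data.Rational.Unnormalised.Properties as ℚᵘ
open import Data.Sum.Base using (_⊎_; inj₁; inj₂)
open import Function.Base using (_∘_)
open import Function.Bundles using (mk⇔)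
open import Level using (0ℓ)
open import Relation.Binary.PropositionalEquality
  using (_≡_; _≢_; refl; sym; trans; cong; cong₂; subst; module ≡-Reasoning)
open import Relation.Nullary.Decidable using (Dec; yes; no; does; does-⇔; dec⇒maybe)
open import Relation.Nullary.Negation using (¬_; contradiction)
open import Tactic.RingSolver using (solve-∀)
open import Tactic.RingSolver.Core.AlmostCommutativeRing
  using (AlmostCommutativeRing; fromCommutativeRing)

open CommSemigroup (CommutativeMonoid.commutativeSemigroup ℚ.+-0-commutativeMonoid)
  using (interchange)
open CommSemigroup (CommutativeMonoid.commutativeSemigroup ℚ.*-1-commutativeMonoid)
  using () renaming (interchange to *-interchange)

-- The weights 1/Z resist the obvious argument. The last factor of `Z α` is the size of `α`, so `D`
-- strips the last part, whereas lists give access to the first. The sums are therefore generalised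
-- to compositions preceded by parts of total `s`, and splitting off the first part changes `s`. If
-- AB = 1, the resulting recursion is solved by the product of B with the series got from A by
-- multiplying each coefficient by s/(s + degree); at `s = 0` this factor keeps only the constant
-- term of A, and the product is B. No ring of series is built. The laws of the product are
-- statements about sums over splittings, phrased for an arbitrary type with a splitting, so that
-- one passage from entries to lists, made twice, leads from exponents to rows and from rows to
-- monomials.

ℚ-ring : AlmostCommutativeRing 0ℓ 0ℓ
ℚ-ring = fromCommutativeRing +-*-commutativeRing (λ q → dec⇒maybe (0ℚ ℚ.≟ q))

-- Natural numbers, signs and reciprocals in `ℚ`

fromℕ-+ : ∀ m n → fromℕ (m ℕ.+ n) ≡ fromℕ m + fromℕ n
-- Sums in `ℚ` are normalised by a gcd and do not compute on variables; unnormalised rationals are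
-- compared by cross-multiplication.
fromℕ-+ m n = ℚ.toℚᵘ-injective (begin
  toℚᵘ (fromℕ (m ℕ.+ n))
    ≈⟨ ℚ.toℚᵘ-fromℚᵘ (mkℚᵘ (ℤ.+ (m ℕ.+ n)) 0) ⟩
  mkℚᵘ (ℤ.+ (m ℕ.+ n)) 0
    ≈⟨ *≡* (cong (ℤ._* ℤ.+ 1) (sym (cong₂ ℤ._+_ (ℤ.*-identityʳ (ℤ.+ m)) (ℤ.*-identityʳ (ℤ.+ n))))) ⟩
  mkℚᵘ (ℤ.+ m) 0 ℚᵘ.+ mkℚᵘ (ℤ.+ n) 0
    ≈⟨ ℚᵘ.+-cong (ℚ.toℚᵘ-fromℚᵘ (mkℚᵘ (ℤ.+ m) 0)) (ℚ.toℚᵘ-fromℚᵘ (mkℚᵘ (ℤ.+ n) 0)) ⟨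
  toℚᵘ (fromℕ m) ℚᵘ.+ toℚᵘ (fromℕ n)
    ≈⟨ ℚ.toℚᵘ-homo-+ (fromℕ m) (fromℕ n) ⟨
  toℚᵘ (fromℕ m + fromℕ n) ∎)
  where open ℚᵘ.≃-Reasoning

open ≡-Reasoning

fromℕ-* : ∀ m n → fromℕ (m ℕ.* n) ≡ fromℕ m * fromℕ n
fromℕ-* zero    n = sym (*-zeroˡ (fromℕ n))
fromℕ-* (suc m) n = begin
  fromℕ (n ℕ.+ m ℕ.* n)          ≡⟨ fromℕ-+ n (m ℕ.* n) ⟩
  fromℕ n + fromℕ (m ℕ.* n)      ≡⟨ cong (fromℕ n +_) (fromℕ-* m n) ⟩
  fromℕ n + fromℕ m * fromℕ n    ≡⟨ factor (fromℕ n) (fromℕ m) ⟩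
  (1ℚ + fromℕ m) * fromℕ n       ≡⟨ cong (_* fromℕ n) (sym (fromℕ-+ 1 m)) ⟩
  fromℕ (suc m) * fromℕ n        ∎
  where
  factor : ∀ p q → p + q * p ≡ (1ℚ + q) * p
  factor = solve-∀ ℚ-ring

-1^-+ : ∀ m n → -1^ (m ℕ.+ n) ≡ -1^ m * -1^ n
-1^-+ zero    n = sym (*-identityˡ (-1^ n))
-1^-+ (suc m) n = trans (cong -_ (-1^-+ m n)) (ℚ.neg-distribˡ-* (-1^ m) (-1^ n))

-- Total, with value 0 at 0, so that multiplicativity holds for all arguments and weights such as
-- `recip (s ℕ.+ k)` carry no proof of nonvanishing.
recip : ℕ → ℚ
recip zero    = 0ℚ
recip (suc k) = ℤ.+ 1 ℚ./ suc k

recip-* : ∀ m n → recip (m ℕ.* n) ≡ recip m * recip n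
recip-* zero    n       = sym (*-zeroˡ (recip n))
recip-* (suc m) zero    rewrite ℕ.*-zeroʳ m = sym (*-zeroʳ (recip (suc m)))
recip-* (suc m) (suc n) = ℚ.toℚᵘ-injective (ℚᵘ.≃-trans
  (ℚ.toℚᵘ-fromℚᵘ (mkℚᵘ (ℤ.+ 1) m ℚᵘ.* mkℚᵘ (ℤ.+ 1) n))
  (ℚᵘ.≃-sym (ℚᵘ.≃-trans (ℚ.toℚᵘ-homo-* (recip (suc m)) (recip (suc n)))
    (ℚᵘ.*-cong (ℚ.toℚᵘ-fromℚᵘ (mkℚᵘ (ℤ.+ 1) m)) (ℚ.toℚᵘ-fromℚᵘ (mkℚᵘ (ℤ.+ 1) n))))))

fromℕ*recip : ∀ k → fromℕ (suc k) * recip (suc k) ≡ 1ℚ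
fromℕ*recip k = ℚ.toℚᵘ-injective (ℚᵘ.≃-trans
  (ℚᵘ.≃-trans (ℚ.toℚᵘ-homo-* (fromℕ (suc k)) (recip (suc k)))
    (ℚᵘ.*-cong (ℚ.toℚᵘ-fromℚᵘ (mkℚᵘ (ℤ.+ suc k) 0)) (ℚ.toℚᵘ-fromℚᵘ (mkℚᵘ (ℤ.+ 1) k))))
  (*≡* (trans (ℤ.*-identityʳ (ℤ.+ suc k ℤ.* ℤ.+ 1)) (trans (ℤ.*-identityʳ (ℤ.+ suc k))
    (sym (trans (ℤ.*-identityˡ (ℤ.+ (1 ℕ.* suc k))) (cong ℤ.+_ (ℕ.*-identityˡ (suc k)))))))))

fromℕ-suc≢0 : ∀ k → fromℕ (suc k) ≢ 0ℚ
fromℕ-suc≢0 k eq = contradiction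
  (trans (sym (*-zeroˡ (recip (suc k)))) (trans (cong (_* recip (suc k)) (sym eq)) (fromℕ*recip k)))
  (λ ())

-- Finite sums

infixr 8 Sum
Sum : ∀ {A : Set} → List A → (A → ℚ) → ℚ
Sum xs f = sumℚ (map f xs)
syntax Sum xs (λ x → e) = Σ[ x ← xs ] e

module _ {A : Set} where

  Σ-cong : ∀ {f g : A → ℚ} xs → (∀ x → f x ≡ g x) → Σ[ x ← xs ] f x ≡ Σ[ x ← xs ] g x
  Σ-cong []       e = refl
  Σ-cong (x ∷ xs) e = cong₂ _+_ (e x) (Σ-cong xs e)

  Σ-0 : ∀ (xs : List A) → Σ[ x ← xs ] 0ℚ ≡ 0ℚ
  Σ-0 []       = refl
  Σ-0 (x ∷ xs) = trans (+-identityˡ _) (Σ-0 xs)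

  Σ-+ : ∀ (f g : A → ℚ) xs →
        Σ[ x ← xs ] (f x + g x) ≡ Σ[ x ← xs ] f x + Σ[ x ← xs ] g x
  Σ-+ f g []       = refl
  Σ-+ f g (x ∷ xs) = trans (cong ((f x + g x) +_) (Σ-+ f g xs)) (interchange (f x) _ _ _)

  Σ-*ˡ : ∀ c (f : A → ℚ) xs → Σ[ x ← xs ] (c * f x) ≡ c * Σ[ x ← xs ] f x
  Σ-*ˡ c f []       = sym (*-zeroʳ c)
  Σ-*ˡ c f (x ∷ xs) = trans (cong (c * f x +_) (Σ-*ˡ c f xs)) (sym (*-distribˡ-+ c _ _))

  Σ-*ʳ : ∀ c (f : A → ℚ) xs → Σ[ x ← xs ] (f x * c) ≡ (Σ[ x ← xs ] f x) * c
  Σ-*ʳ c f []       = sym (*-zeroˡ c)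
  Σ-*ʳ c f (x ∷ xs) = trans (cong (f x * c +_) (Σ-*ʳ c f xs)) (sym (*-distribʳ-+ c (f x) _))

  Σ-++ : ∀ (f : A → ℚ) xs ys → Σ[ x ← xs ++ ys ] f x ≡ Σ[ x ← xs ] f x + Σ[ x ← ys ] f x
  Σ-++ f []       ys = sym (+-identityˡ _)
  Σ-++ f (x ∷ xs) ys = trans (cong (f x +_) (Σ-++ f xs ys)) (sym (+-assoc (f x) _ _))

module _ {A B : Set} where

  Σ-map : ∀ (f : B → ℚ) (g : A → B) xs → Σ[ y ← map g xs ] f y ≡ Σ[ x ← xs ] f (g x)
  Σ-map f g []       = refl
  Σ-map f g (x ∷ xs) = cong (f (g x) +_) (Σ-map f g xs)

  Σ-concatMap : ∀ (f : B → ℚ) (g : A → List B) xs →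
                Σ[ y ← concatMap g xs ] f y ≡ Σ[ x ← xs ] Σ[ y ← g x ] f y
  Σ-concatMap f g []       = refl
  Σ-concatMap f g (x ∷ xs) =
    trans (Σ-++ f (g x) _) (cong (Sum (g x) f +_) (Σ-concatMap f g xs))

  Σ-swap : ∀ (f : A → B → ℚ) xs ys →
           Σ[ x ← xs ] Σ[ y ← ys ] f x y ≡ Σ[ y ← ys ] Σ[ x ← xs ] f x y
  Σ-swap f []       ys = sym (Σ-0 ys)
  Σ-swap f (x ∷ xs) ys =
    trans (cong (Sum ys (f x) +_) (Σ-swap f xs ys)) (sym (Σ-+ (f x) _ ys))

  Σ-× : ∀ {C : Set} (h : A → B → C) (f : C → ℚ) xs ys →
        Σ[ z ← cartesianProductWith h xs ys ] f z ≡ Σ[ x ← xs ] Σ[ y ← ys ] f (h x y)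
  Σ-× h f []       ys = refl
  Σ-× h f (x ∷ xs) ys = trans (Σ-++ f (map (h x) ys) _) (cong₂ _+_ (go ys) (Σ-× h f xs ys))
    where
    go : ∀ ys → Σ[ z ← map (h x) ys ] f z ≡ Σ[ y ← ys ] f (h x y)
    go []       = refl
    go (y ∷ ys) = cong (f (h x y) +_) (go ys)

-- Conditions as factors 0 and 1

bit : Bool → ℚ
bit b = if b then 1ℚ else 0ℚ

𝟙 : ∀ {P : Set} → Dec P → ℚ
𝟙 P? = bit (does P?)

bit-∧ : ∀ a b → bit (a ∧ b) ≡ bit a * bit b
bit-∧ true  b = sym (*-identityˡ (bit b))
bit-∧ false b = sym (*-zeroˡ (bit b))

bit-* : ∀ b q → (if b then q else 0ℚ) ≡ bit b * q
bit-* true  q = sym (*-identityˡ q)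
bit-* false q = sym (*-zeroˡ q)

𝟙-yes : ∀ {P : Set} (P? : Dec P) → P → 𝟙 P? ≡ 1ℚ
𝟙-yes (yes _) p = refl
𝟙-yes (no ¬p) p = contradiction p ¬p

𝟙-no : ∀ {P : Set} (P? : Dec P) → ¬ P → 𝟙 P? ≡ 0ℚ
𝟙-no (yes p) ¬p = contradiction p ¬p
𝟙-no (no _)  ¬p = refl

-- Convolution along splittings

infixr 8 Sum₂

Sum₂ : ∀ {A B : Set} → List (A × B) → (A → B → ℚ) → ℚ
Sum₂ ps f = Sum ps (uncurry f)

syntax Sum₂ ps (λ a b → e) = Σ[ a , b ← ps ] e

Splitting : Set → Set
Splitting A = A → List (A × A)

convolution : ∀ {A : Set} → Splitting A → (A → ℚ) → (A → ℚ) → A → ℚ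
convolution s f g x = Σ[ a , b ← s x ] (f a * g b)

Σ-*-Σ : ∀ {A B : Set} (f : A → ℚ) (g : B → ℚ) xs ys →
        Σ[ x ← xs ] Σ[ y ← ys ] (f x * g y) ≡ (Σ[ x ← xs ] f x) * (Σ[ y ← ys ] g y)
Σ-*-Σ f g xs ys = trans (Σ-cong xs (λ x → Σ-*ˡ (f x) g ys)) (Σ-*ʳ (Sum ys g) f xs)

Counitalˡ : ∀ {A : Set} → Splitting A → (A → ℚ) → Set
Counitalˡ s δ = ∀ φ x → convolution s δ φ x ≡ φ x

Counitalʳ : ∀ {A : Set} → Splitting A → (A → ℚ) → Set
Counitalʳ s δ = ∀ φ x → convolution s φ δ x ≡ φ x

-- The summand is any function of three pieces, not a product of three functions: the induction over
-- lists needs whole sums as summands, and `t-step` needs a factor involving two of the pieces.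
Coassociative : ∀ {A : Set} → Splitting A → Set
Coassociative {A} s = ∀ (f : A → A → A → ℚ) x →
  Σ[ u , c ← s x ] Σ[ a , b ← s u ] f a b c ≡ Σ[ a , v ← s x ] Σ[ b , c ← s v ] f a b c

-- Replaces reasoning about membership in the list of splittings: a summand may be rewritten using
-- that the degrees of the pieces add up to that of the whole.
Graded : ∀ {A : Set} → Splitting A → (A → ℕ) → Set
Graded s deg = ∀ f g x → (∀ a b → deg a ℕ.+ deg b ≡ deg x → f a b ≡ g a b) →
               Sum₂ (s x) f ≡ Sum₂ (s x) g

-- Substituting x ↦ x^r is multiplicative; pw indicates the r-th powers.

Dilatable : ∀ {A : Set} → Splitting A → (A → ℚ) → (A → A) → Set
Dilatable s pw rt = ∀ f x →
  Σ[ a , b ← s x ] ((pw a * pw b) * f (rt a) (rt b)) ≡ pw x * Sum₂ (s (rt x)) f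

prod : ∀ {A : Set} → (A → ℚ) → List A → ℚ
prod φ []       = 1ℚ
prod φ (x ∷ xs) = φ x * prod φ xs

prod-cong : ∀ {A : Set} {φ ψ : A → ℚ} → (∀ x → φ x ≡ ψ x) → ∀ xs → prod φ xs ≡ prod ψ xs
prod-cong e []       = refl
prod-cong e (x ∷ xs) = cong₂ _*_ (e x) (prod-cong e xs)

prod-* : ∀ {A : Set} (φ ψ : A → ℚ) xs → prod φ xs * prod ψ xs ≡ prod (λ x → φ x * ψ x) xs
prod-* φ ψ []       = *-identityˡ 1ℚ
prod-* φ ψ (x ∷ xs) =
  trans (*-interchange (φ x) _ _ _) (cong (φ x * ψ x *_) (prod-* φ ψ xs))

prod-1 : ∀ {A : Set} {φ : A → ℚ} → (∀ x → φ x ≡ 1ℚ) → ∀ xs → prod φ xs ≡ 1ℚ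
prod-1 e []       = refl
prod-1 e (x ∷ xs) = trans (cong₂ _*_ (e x) (prod-1 e xs)) (*-identityˡ 1ℚ)

prod-map : ∀ {A : Set} (φ : A → ℚ) (f : A → A) xs → prod φ (map f xs) ≡ prod (φ ∘ f) xs
prod-map φ f []       = refl
prod-map φ f (x ∷ xs) = cong (φ (f x) *_) (prod-map φ f xs)

-- The δ-derivation on lists with value q i x on a list which is trivial
-- (in the sense of δ) except for the entry x at position i.

derivation : ∀ {A : Set} → (A → ℚ) → (ℕ → A → ℚ) → List A → ℚ
derivation δ q []       = 0ℚ
derivation δ q (x ∷ xs) = q 0 x * prod δ xs + δ x * derivation δ (q ∘ suc) xs

-- Lifting the laws of a splitting to lists

module _ {A : Set} (s : Splitting A) where

  private
    sL : Splitting (List A)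
    sL = splittingsList s

  split-∷ : ∀ f x xs → Sum₂ (sL (x ∷ xs)) f ≡
            Σ[ a , b ← s x ] Σ[ as , bs ← sL xs ] f (a ∷ as) (b ∷ bs)
  split-∷ f x xs = Σ-× _ (uncurry f) (s x) (sL xs)

  convolution-∷ : ∀ f g h k x xs →
    (∀ a b as bs → f (a ∷ as) * g (b ∷ bs) ≡ h a b * k as bs) →
    convolution sL f g (x ∷ xs) ≡ Sum₂ (s x) h * Sum₂ (sL xs) k
  convolution-∷ f g h k x xs e = begin
    convolution sL f g (x ∷ xs)
      ≡⟨ split-∷ (λ as bs → f as * g bs) x xs ⟩
    Σ[ a , b ← s x ] Σ[ as , bs ← sL xs ] (f (a ∷ as) * g (b ∷ bs))
      ≡⟨ Σ-cong (s x) (λ (a , b) → Σ-cong (sL xs) (λ (as , bs) → e a b as bs)) ⟩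
    Σ[ a , b ← s x ] Σ[ as , bs ← sL xs ] (h a b * k as bs)
      ≡⟨ Σ-*-Σ (uncurry h) (uncurry k) (s x) (sL xs) ⟩
    Sum₂ (s x) h * Sum₂ (sL xs) k ∎

  -- Entries are split independently of each other, so an identity in one variable carries over to
  -- the products over all variables.
  convolution-prod : ∀ φ ψ χ → (∀ x → convolution s φ ψ x ≡ χ x) →
                     ∀ xs → convolution sL (prod φ) (prod ψ) xs ≡ prod χ xs
  convolution-prod φ ψ χ e []       = refl
  convolution-prod φ ψ χ e (x ∷ xs) = trans
    (convolution-∷ (prod φ) (prod ψ) (λ a b → φ a * ψ b) (λ as bs → prod φ as * prod ψ bs) x xs
      (λ a b as bs → *-interchange (φ a) _ _ _))
    (cong₂ _*_ (e x) (convolution-prod φ ψ χ e xs))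

  counitˡ-list : ∀ {δ} → Counitalˡ s δ → Counitalˡ sL (prod δ)
  counitˡ-list         cu φ []       = trans (+-identityʳ _) (*-identityˡ _)
  counitˡ-list {δ} cu φ (x ∷ xs) = begin
    convolution sL (prod δ) φ (x ∷ xs)
      ≡⟨ split-∷ (λ as bs → prod δ as * φ bs) x xs ⟩
    Σ[ a , b ← s x ] Σ[ as , bs ← sL xs ] ((δ a * prod δ as) * φ (b ∷ bs))
      ≡⟨ Σ-cong (s x) (λ (a , b) → trans
           (Σ-cong (sL xs) (λ (as , bs) → *-assoc (δ a) (prod δ as) (φ (b ∷ bs))))
           (Σ-*ˡ (δ a) (uncurry (λ as bs → prod δ as * φ (b ∷ bs))) (sL xs))) ⟩
    Σ[ a , b ← s x ] (δ a * convolution sL (prod δ) (φ ∘ (b ∷_)) xs)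
      ≡⟨ Σ-cong (s x) (λ (a , b) → cong (δ a *_) (counitˡ-list cu (φ ∘ (b ∷_)) xs)) ⟩
    convolution s δ (λ b → φ (b ∷ xs)) x
      ≡⟨ cu (λ b → φ (b ∷ xs)) x ⟩
    φ (x ∷ xs) ∎

  counitʳ-list : ∀ {δ} → Counitalʳ s δ → Counitalʳ sL (prod δ)
  counitʳ-list         cu φ []       = trans (+-identityʳ _) (*-identityʳ _)
  counitʳ-list {δ} cu φ (x ∷ xs) = begin
    convolution sL φ (prod δ) (x ∷ xs)
      ≡⟨ split-∷ (λ as bs → φ as * prod δ bs) x xs ⟩
    Σ[ a , b ← s x ] Σ[ as , bs ← sL xs ] (φ (a ∷ as) * (δ b * prod δ bs))
      ≡⟨ Σ-cong (s x) (λ (a , b) → trans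
           (Σ-cong (sL xs) (λ (as , bs) → rearrange (φ (a ∷ as)) (δ b) (prod δ bs)))
           (Σ-*ʳ (δ b) (uncurry (λ as bs → φ (a ∷ as) * prod δ bs)) (sL xs))) ⟩
    Σ[ a , b ← s x ] (convolution sL (φ ∘ (a ∷_)) (prod δ) xs * δ b)
      ≡⟨ Σ-cong (s x) (λ (a , b) → cong (_* δ b) (counitʳ-list cu (φ ∘ (a ∷_)) xs)) ⟩
    convolution s (λ a → φ (a ∷ xs)) δ x
      ≡⟨ cu (λ a → φ (a ∷ xs)) x ⟩
    φ (x ∷ xs) ∎
    where
    rearrange : ∀ p q r → p * (q * r) ≡ (p * r) * q
    rearrange = solve-∀ ℚ-ring

  -- Once the sums are interchanged, the induction hypothesis regroups the tails and `co` the heads,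
  -- with the double sum over tails as its summand.
  coassociative-list : Coassociative s → Coassociative sL
  coassociative-list co f []       = refl
  coassociative-list co f (x ∷ xs) = begin
    Σ[ us , cs ← sL (x ∷ xs) ] Σ[ as , bs ← sL us ] f as bs cs
      ≡⟨ split-∷ _ x xs ⟩
    Σ[ u , c ← s x ] Σ[ us , cs ← sL xs ] Σ[ as , bs ← sL (u ∷ us) ] f as bs (c ∷ cs)
      ≡⟨ Σ-cong (s x) (λ (u , c) → trans
           (Σ-cong (sL xs) (λ (us , cs) → split-∷ (λ as bs → f as bs (c ∷ cs)) u us))
           (Σ-swap _ (sL xs) (s u))) ⟩
    Σ[ u , c ← s x ] Σ[ a , b ← s u ] Σ[ us , cs ← sL xs ] Σ[ as , bs ← sL us ]
      f (a ∷ as) (b ∷ bs) (c ∷ cs)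
      ≡⟨ Σ-cong (s x) (λ (u , c) → Σ-cong (s u) (λ (a , b) →
           coassociative-list co (λ as bs cs → f (a ∷ as) (b ∷ bs) (c ∷ cs)) xs)) ⟩
    Σ[ u , c ← s x ] Σ[ a , b ← s u ] Σ[ as , vs ← sL xs ] Σ[ bs , cs ← sL vs ]
      f (a ∷ as) (b ∷ bs) (c ∷ cs)
      ≡⟨ co (λ a b c → Σ[ as , vs ← sL xs ] Σ[ bs , cs ← sL vs ]
              f (a ∷ as) (b ∷ bs) (c ∷ cs)) x ⟩
    Σ[ a , v ← s x ] Σ[ b , c ← s v ] Σ[ as , vs ← sL xs ] Σ[ bs , cs ← sL vs ]
      f (a ∷ as) (b ∷ bs) (c ∷ cs)
      ≡⟨ Σ-cong (s x) (λ (a , v) → sym (trans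
           (Σ-cong (sL xs) (λ (as , vs) → split-∷ (λ bs cs → f (a ∷ as) bs cs) v vs))
           (Σ-swap _ (sL xs) (s v)))) ⟩
    Σ[ a , v ← s x ] Σ[ as , vs ← sL xs ] Σ[ bs , cs ← sL (v ∷ vs) ] f (a ∷ as) bs cs
      ≡⟨ sym (split-∷ _ x xs) ⟩
    Σ[ as , vs ← sL (x ∷ xs) ] Σ[ bs , cs ← sL vs ] f as bs cs ∎

  -- The degree may depend on the position because the indeterminates of row `i` have degree
  -- `suc i`.
  graded-list : ∀ deg → (∀ i → Graded s (deg i)) → Graded sL (sumAt deg)
  graded-list deg gr f g []       e = cong (_+ 0ℚ) (e [] [] refl)
  graded-list deg gr f g (x ∷ xs) e = begin
    Sum₂ (sL (x ∷ xs)) f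
      ≡⟨ split-∷ f x xs ⟩
    Σ[ a , b ← s x ] Σ[ as , bs ← sL xs ] f (a ∷ as) (b ∷ bs)
      ≡⟨ gr 0 _ _ x (λ a b p → graded-list (deg ∘ suc) (gr ∘ suc) _ _ xs
           (λ as bs ps → e (a ∷ as) (b ∷ bs)
             (trans (ℕ-interchange (deg 0 a) _ (deg 0 b) _) (cong₂ ℕ._+_ p ps)))) ⟩
    Σ[ a , b ← s x ] Σ[ as , bs ← sL xs ] g (a ∷ as) (b ∷ bs)
      ≡⟨ sym (split-∷ g x xs) ⟩
    Sum₂ (sL (x ∷ xs)) g ∎
    where
    open CommSemigroup ℕ.+-commutativeSemigroup using () renaming (interchange to ℕ-interchange)

  dilatable-list : ∀ {pw rt} → Dilatable s pw rt → Dilatable sL (prod pw) (map rt)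
  dilatable-list           di f []       = unit (f [] [])
    where
    unit : ∀ q → (1ℚ * 1ℚ) * q + 0ℚ ≡ 1ℚ * (q + 0ℚ)
    unit = solve-∀ ℚ-ring
  dilatable-list {pw} {rt} di f (x ∷ xs) = begin
    Σ[ as , bs ← sL (x ∷ xs) ] ((prod pw as * prod pw bs) * f (map rt as) (map rt bs))
      ≡⟨ split-∷ _ x xs ⟩
    Σ[ a , b ← s x ] Σ[ as , bs ← sL xs ]
      (((pw a * prod pw as) * (pw b * prod pw bs)) * f (rt a ∷ map rt as) (rt b ∷ map rt bs))
      ≡⟨ Σ-cong (s x) (λ (a , b) → begin
           Σ[ as , bs ← sL xs ]
             (((pw a * prod pw as) * (pw b * prod pw bs)) * f (rt a ∷ map rt as) (rt b ∷ map rt bs))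
             ≡⟨ Σ-cong (sL xs) (λ (as , bs) → rearrange (pw a) _ (pw b) _ _) ⟩
           Σ[ as , bs ← sL xs ]
             ((pw a * pw b) * ((prod pw as * prod pw bs) * f (rt a ∷ map rt as) (rt b ∷ map rt bs)))
             ≡⟨ Σ-*ˡ (pw a * pw b) _ (sL xs) ⟩
           (pw a * pw b) * (Σ[ as , bs ← sL xs ]
             ((prod pw as * prod pw bs) * f (rt a ∷ map rt as) (rt b ∷ map rt bs)))
             ≡⟨ cong ((pw a * pw b) *_)
                  (dilatable-list di (λ as bs → f (rt a ∷ as) (rt b ∷ bs)) xs) ⟩
           (pw a * pw b) * (prod pw xs * Sum₂ (sL (map rt xs)) (λ as bs → f (rt a ∷ as) (rt b ∷ bs))) ∎) ⟩
    Σ[ a , b ← s x ] ((pw a * pw b) *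
      (prod pw xs * Σ[ as , bs ← sL (map rt xs) ] f (rt a ∷ as) (rt b ∷ bs)))
      ≡⟨ di (λ a b → prod pw xs * Σ[ as , bs ← sL (map rt xs) ] f (a ∷ as) (b ∷ bs)) x ⟩
    pw x * (Σ[ a , b ← s (rt x) ] (prod pw xs * Σ[ as , bs ← sL (map rt xs) ] f (a ∷ as) (b ∷ bs)))
      ≡⟨ cong (pw x *_) (Σ-*ˡ (prod pw xs) _ (s (rt x))) ⟩
    pw x * (prod pw xs * (Σ[ a , b ← s (rt x) ] Σ[ as , bs ← sL (map rt xs) ] f (a ∷ as) (b ∷ bs)))
      ≡⟨ sym (*-assoc (pw x) _ _) ⟩
    (pw x * prod pw xs) * (Σ[ a , b ← s (rt x) ] Σ[ as , bs ← sL (map rt xs) ] f (a ∷ as) (b ∷ bs))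
      ≡⟨ cong ((pw x * prod pw xs) *_) (sym (split-∷ f (rt x) (map rt xs))) ⟩
    (pw x * prod pw xs) * Sum₂ (sL (map rt (x ∷ xs))) f ∎
    where
    rearrange : ∀ p q r t u → ((p * q) * (r * t)) * u ≡ (p * r) * ((q * t) * u)
    rearrange = solve-∀ ℚ-ring

  -- The Leibniz rule: each summand of the derivation acts on one entry through `q` and on the
  -- others through the counit, which leaves `φ` unchanged, so the numbers `d i x` add up. The
  -- constant `c` will be the sign that distinguishes 1/(1 - t) from 1 - t.
  convolution-derivation :
    ∀ c δ φ → Counitalˡ s δ →
    ∀ q (d : ℕ → A → ℕ) → (∀ i x → convolution s (q i) φ x ≡ (c * fromℕ (d i x)) * φ x) →
    ∀ xs → convolution sL (derivation δ q) (prod φ) xs ≡ (c * fromℕ (sumAt d xs)) * prod φ xs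
  convolution-derivation c δ φ cu q d e []       = cong (_* 1ℚ) (sym (*-zeroʳ c))
  convolution-derivation c δ φ cu q d e (x ∷ xs) = begin
    convolution sL (derivation δ q) (prod φ) (x ∷ xs)
      ≡⟨ split-∷ _ x xs ⟩
    Σ[ a , b ← s x ] Σ[ as , bs ← sL xs ]
      ((q 0 a * prod δ as + δ a * Q as) * (φ b * prod φ bs))
      ≡⟨ Σ-cong (s x) (λ (a , b) → trans
           (Σ-cong (sL xs) (λ (as , bs) → rearrange (q 0 a) (prod δ as) (δ a) (Q as) (φ b) (prod φ bs)))
           (Σ-+ _ _ (sL xs))) ⟩
    Σ[ a , b ← s x ] (
      Σ[ as , bs ← sL xs ] ((q 0 a * φ b) * (prod δ as * prod φ bs)) +
      Σ[ as , bs ← sL xs ] ((δ a * φ b) * (Q as * prod φ bs)))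
      ≡⟨ Σ-+ _ _ (s x) ⟩
    Σ[ a , b ← s x ] Σ[ as , bs ← sL xs ] ((q 0 a * φ b) * (prod δ as * prod φ bs)) +
    Σ[ a , b ← s x ] Σ[ as , bs ← sL xs ] ((δ a * φ b) * (Q as * prod φ bs))
      ≡⟨ cong₂ _+_ (Σ-*-Σ (λ (a , b) → q 0 a * φ b) _ (s x) (sL xs))
                   (Σ-*-Σ (λ (a , b) → δ a * φ b) _ (s x) (sL xs)) ⟩
    convolution s (q 0) φ x * convolution sL (prod δ) (prod φ) xs +
    convolution s δ φ x * convolution sL Q (prod φ) xs
      ≡⟨ cong₂ _+_ (cong₂ _*_ (e 0 x) (counitˡ-list cu (prod φ) xs))
                   (cong₂ _*_ (cu φ x)
                     (convolution-derivation c δ φ cu (q ∘ suc) (d ∘ suc) (e ∘ suc) xs)) ⟩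
    ((c * fromℕ (d 0 x)) * φ x) * prod φ xs +
    φ x * ((c * fromℕ (sumAt (d ∘ suc) xs)) * prod φ xs)
      ≡⟨ collect c (fromℕ (d 0 x)) _ (φ x) (prod φ xs) ⟩
    (c * (fromℕ (d 0 x) + fromℕ (sumAt (d ∘ suc) xs))) * (φ x * prod φ xs)
      ≡⟨ cong (λ k → (c * k) * (φ x * prod φ xs)) (sym (fromℕ-+ (d 0 x) _)) ⟩
    (c * fromℕ (sumAt d (x ∷ xs))) * prod φ (x ∷ xs) ∎
    where
    Q : List A → ℚ
    Q = derivation δ (q ∘ suc)
    rearrange : ∀ p q r t u v → (p * q + r * t) * (u * v) ≡ (p * u) * (q * v) + (r * u) * (t * v)
    rearrange = solve-∀ ℚ-ring
    collect : ∀ c m n p q → ((c * m) * p) * q + p * ((c * n) * q) ≡ (c * (m + n)) * (p * q)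
    collect = solve-∀ ℚ-ring

-- Power series in one variable

Σ-splittingsℕ : ∀ f n → Sum₂ (splittingsℕ (suc n)) f ≡
                f 0 (suc n) + Σ[ a , b ← splittingsℕ n ] f (suc a) b
-- The pair with first component 0 splits off by computation; the others are reindexed by `suc`,
-- where the truncated difference loses one on both sides.
Σ-splittingsℕ f n = cong (f 0 (suc n) +_) (begin
  Sum₂ (map (λ i → i , suc n ℕ.∸ i) (applyUpTo suc (suc n))) f
    ≡⟨ cong (λ is → Sum₂ (map (λ i → i , suc n ℕ.∸ i) is) f) (sym (map-upTo suc (suc n))) ⟩
  Sum₂ (map (λ i → i , suc n ℕ.∸ i) (map suc (upTo (suc n)))) f
    ≡⟨ trans (Σ-map (uncurry f) (λ i → i , suc n ℕ.∸ i) (map suc (upTo (suc n))))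
               (Σ-map (λ i → f i (suc n ℕ.∸ i)) suc (upTo (suc n))) ⟩
  Σ[ i ← upTo (suc n) ] f (suc i) (n ℕ.∸ i)
    ≡⟨ sym (Σ-map (λ (a , b) → f (suc a) b) (λ i → i , n ℕ.∸ i) (upTo (suc n))) ⟩
  Σ[ a , b ← splittingsℕ n ] f (suc a) b ∎)

graded-ℕ : ∀ w → Graded splittingsℕ (w ℕ.*_)
graded-ℕ w f g n e =
  go f g n (λ a b p → e a b (trans (sym (ℕ.*-distribˡ-+ w a b)) (cong (w ℕ.*_) p)))
  where
  go : ∀ f g n → (∀ a b → a ℕ.+ b ≡ n → f a b ≡ g a b) →
       Sum₂ (splittingsℕ n) f ≡ Sum₂ (splittingsℕ n) g
  go f g zero    e = cong (_+ 0ℚ) (e 0 0 refl)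
  go f g (suc n) e = begin
    Sum₂ (splittingsℕ (suc n)) f
      ≡⟨ Σ-splittingsℕ f n ⟩
    f 0 (suc n) + Σ[ a , b ← splittingsℕ n ] f (suc a) b
      ≡⟨ cong₂ _+_ (e 0 (suc n) refl) (go _ _ n (λ a b p → e (suc a) b (cong suc p))) ⟩
    g 0 (suc n) + Σ[ a , b ← splittingsℕ n ] g (suc a) b
      ≡⟨ sym (Σ-splittingsℕ g n) ⟩
    Sum₂ (splittingsℕ (suc n)) g ∎

-- Triples with first component 0 split off on both sides; decrementing that component in the others
-- gives the induction hypothesis.
coassociative-ℕ : Coassociative splittingsℕ
coassociative-ℕ f zero    = refl
coassociative-ℕ f (suc n) = begin
  Σ[ u , c ← splittingsℕ (suc n) ] Σ[ a , b ← splittingsℕ u ] f a b c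
    ≡⟨ Σ-splittingsℕ (λ u c → Σ[ a , b ← splittingsℕ u ] f a b c) n ⟩
  (f 0 0 (suc n) + 0ℚ) + Σ[ u , c ← splittingsℕ n ] Σ[ a , b ← splittingsℕ (suc u) ] f a b c
    ≡⟨ cong₂ _+_ (+-identityʳ (f 0 0 (suc n)))
         (trans (Σ-cong (splittingsℕ n) (λ (u , c) → Σ-splittingsℕ (λ a b → f a b c) u))
                (Σ-+ (λ (u , c) → f 0 (suc u) c)
                     (λ (u , c) → Σ[ a , b ← splittingsℕ u ] f (suc a) b c) (splittingsℕ n))) ⟩
  f 0 0 (suc n) + (Σ[ u , c ← splittingsℕ n ] f 0 (suc u) c +
    Σ[ u , c ← splittingsℕ n ] Σ[ a , b ← splittingsℕ u ] f (suc a) b c)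
    ≡⟨ sym (+-assoc (f 0 0 (suc n)) _ _) ⟩
  (f 0 0 (suc n) + Σ[ u , c ← splittingsℕ n ] f 0 (suc u) c) +
    Σ[ u , c ← splittingsℕ n ] Σ[ a , b ← splittingsℕ u ] f (suc a) b c
    ≡⟨ cong₂ _+_ (sym (Σ-splittingsℕ (f 0) n)) (coassociative-ℕ (f ∘ suc) n) ⟩
  Sum₂ (splittingsℕ (suc n)) (f 0) +
    Σ[ a , v ← splittingsℕ n ] Σ[ b , c ← splittingsℕ v ] f (suc a) b c
    ≡⟨ sym (Σ-splittingsℕ (λ a v → Σ[ b , c ← splittingsℕ v ] f a b c) n) ⟩
  Σ[ a , v ← splittingsℕ (suc n) ] Σ[ b , c ← splittingsℕ v ] f a b c ∎

δ₀ : ℕ → ℚ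
δ₀ n = 𝟙 (n ≟ 0)

convolution-suc : ∀ φ ψ n → convolution splittingsℕ φ ψ (suc n) ≡
                  φ 0 * ψ (suc n) + convolution splittingsℕ (φ ∘ suc) ψ n
convolution-suc φ ψ n = Σ-splittingsℕ (λ a b → φ a * ψ b) n

convolution-0 : ∀ φ ψ n → (∀ a → φ a ≡ 0ℚ) → convolution splittingsℕ φ ψ n ≡ 0ℚ
convolution-0 φ ψ n e = trans
  (Σ-cong (splittingsℕ n) (λ (a , b) → trans (cong (_* ψ b) (e a)) (*-zeroˡ (ψ b))))
  (Σ-0 (splittingsℕ n))

convolution-head : ∀ φ ψ n → (∀ a → φ (suc a) ≡ 0ℚ) →
                   convolution splittingsℕ φ ψ n ≡ φ 0 * ψ n
convolution-head φ ψ zero    e = +-identityʳ _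
convolution-head φ ψ (suc n) e = trans (convolution-suc φ ψ n)
  (trans (cong (φ 0 * ψ (suc n) +_) (convolution-0 (φ ∘ suc) ψ n e)) (+-identityʳ _))

counitˡ-ℕ : Counitalˡ splittingsℕ δ₀
counitˡ-ℕ φ n = trans (convolution-head δ₀ φ n (λ _ → refl)) (*-identityˡ (φ n))

counitʳ-ℕ : Counitalʳ splittingsℕ δ₀
counitʳ-ℕ φ zero    = trans (+-identityʳ _) (*-identityʳ _)
counitʳ-ℕ φ (suc n) = trans (convolution-suc φ δ₀ n)
  (trans (cong₂ _+_ (*-zeroʳ (φ 0)) (counitʳ-ℕ (φ ∘ suc) n)) (+-identityˡ _))

one : ℕ → ℚ
one _ = 1ℚ

-- The coefficients of 1 + q t.

linear : ℚ → ℕ → ℚ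
linear q zero          = 1ℚ
linear q (suc zero)    = q
linear q (suc (suc _)) = 0ℚ

-- Comes from 1/(1 - t) = 1 + t/(1 - t): convolving with `one` forms partial sums.
one-convolution : ∀ ψ n → convolution splittingsℕ one ψ (suc n) ≡
                  ψ (suc n) + convolution splittingsℕ one ψ n
one-convolution ψ n = trans (convolution-suc one ψ n) 
  (cong (_+ convolution splittingsℕ one ψ n) (*-identityˡ (ψ (suc n))))

one⋆linear : ∀ n → convolution splittingsℕ one (linear (- 1ℚ)) n ≡ δ₀ n
one⋆linear zero          = refl
one⋆linear (suc zero)    = refl
-- From degree 2 on `linear` contributes nothing, so the partial sums keep the value 0 reached in
-- degree 1.
one⋆linear (suc (suc n)) =
  trans (one-convolution (linear (- 1ℚ)) (suc n)) 
    (trans (+-identityˡ (convolution splittingsℕ one (linear (- 1ℚ)) (suc n))) (one⋆linear (suc n)))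

linear⋆ : ∀ q ψ n → convolution splittingsℕ (linear q) ψ (suc n) ≡ ψ (suc n) + q * ψ n
linear⋆ q ψ n = trans (convolution-suc (linear q) ψ n)
  (cong₂ _+_ (*-identityˡ (ψ (suc n))) (convolution-head (linear q ∘ suc) ψ n (λ _ → refl)))

linear⋆one : ∀ n → convolution splittingsℕ (linear (- 1ℚ)) one n ≡ δ₀ n
linear⋆one zero    = refl
linear⋆one (suc n) = linear⋆ (- 1ℚ) one n

-- The coefficients of t / (1 - t).

positive : ℕ → ℚ
positive zero    = 0ℚ
positive (suc _) = 1ℚ

positive⋆ : ∀ ψ n → convolution splittingsℕ positive ψ (suc n) ≡ convolution splittingsℕ one ψ n
positive⋆ ψ n = trans (convolution-suc positive ψ n)
  (trans (cong (_+ convolution splittingsℕ one ψ n) (*-zeroˡ (ψ (suc n)))) (+-identityˡ _))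

one⋆one : ∀ n → convolution splittingsℕ one one n ≡ fromℕ (suc n)
one⋆one zero    = refl
one⋆one (suc n) = trans (one-convolution one n)
  (trans (cong (1ℚ +_) (one⋆one n)) (sym (fromℕ-+ 1 (suc n))))

-- The logarithmic derivative, with respect to t d/dt, of 1/(1 - t) is t/(1 - t), and that of 1 - t
-- is its negative. The factor `1ℚ` is the `c` of `convolution-derivation`.
positive⋆one : ∀ n → convolution splittingsℕ positive one n ≡ (1ℚ * fromℕ n) * one n
positive⋆one zero    = refl
positive⋆one (suc n) = trans (positive⋆ one n) (trans (one⋆one n) (unit (fromℕ (suc n))))
  where
  unit : ∀ q → q ≡ (1ℚ * q) * 1ℚ
  unit = solve-∀ ℚ-ring

positive⋆linear : ∀ n → convolution splittingsℕ positive (linear (- 1ℚ)) n ≡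
                  (- 1ℚ * fromℕ n) * linear (- 1ℚ) n
positive⋆linear zero          = refl
positive⋆linear (suc zero)    = refl
positive⋆linear (suc (suc n)) =
  trans (positive⋆ (linear (- 1ℚ)) (suc n)) 
    (trans (one⋆linear (suc n)) (sym (*-zeroʳ (- 1ℚ * fromℕ (suc (suc n))))))

even : ℕ → ℚ
even n = 𝟙 (2 ∣? n)

2+n/2 : ∀ n → suc (suc n) / 2 ≡ suc (n / 2)
2+n/2 n = m/n≡1+[m∸n]/n {suc (suc n)} {2} (s≤s (s≤s z≤n))

even-2+n : ∀ n → even (suc (suc n)) ≡ even n
even-2+n n = cong bit (does-⇔
  (mk⇔ (λ d → ∣m+n∣m⇒∣n d ∣-refl) (∣m∣n⇒∣m+n ∣-refl)) (2 ∣? suc (suc n)) (2 ∣? n))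

-- Induction in steps of two: the pairs with first component 0 and 1 split off, and the latter
-- vanishes because 1 is odd.
dilatable-ℕ : Dilatable splittingsℕ even (_/ 2)
dilatable-ℕ f zero          = unit (f 0 0)
  where
  unit : ∀ q → (1ℚ * 1ℚ) * q + 0ℚ ≡ 1ℚ * (q + 0ℚ)
  unit = solve-∀ ℚ-ring
dilatable-ℕ f (suc zero)    = vanish (f 0 0)
  where
  vanish : ∀ q → (1ℚ * 0ℚ) * q + ((0ℚ * 1ℚ) * q + 0ℚ) ≡ 0ℚ * (q + 0ℚ)
  vanish = solve-∀ ℚ-ring
dilatable-ℕ f (suc (suc n)) = begin
  Sum₂ (splittingsℕ (suc (suc n))) F
    ≡⟨ trans (Σ-splittingsℕ F (suc n)) (cong (F 0 (suc (suc n)) +_) (Σ-splittingsℕ (F ∘ suc) n)) ⟩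
  F 0 (suc (suc n)) + (F 1 (suc n) + Σ[ a , b ← splittingsℕ n ] F (suc (suc a)) b)
    ≡⟨ cong₂ _+_
         (cong₂ (λ p k → (1ℚ * p) * f 0 k) (even-2+n n) (2+n/2 n))
         (cong (F 1 (suc n) +_) (Σ-cong (splittingsℕ n) (λ (a , b) →
           cong₂ (λ p k → (p * even b) * f k (b / 2)) (even-2+n a) (2+n/2 a)))) ⟩
  (1ℚ * even n) * f 0 (suc (n / 2)) + (F 1 (suc n) +
    Σ[ a , b ← splittingsℕ n ] ((even a * even b) * f (suc (a / 2)) (b / 2)))
    ≡⟨ cong (λ q → (1ℚ * even n) * f 0 (suc (n / 2)) + (F 1 (suc n) + q))
         (dilatable-ℕ (f ∘ suc) n) ⟩
  (1ℚ * even n) * f 0 (suc (n / 2)) + ((0ℚ * even (suc n)) * f 0 (suc n / 2) +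
    even n * Sum₂ (splittingsℕ (n / 2)) (f ∘ suc))
    ≡⟨ collect (even n) _ (even (suc n)) _ _ ⟩
  even n * (f 0 (suc (n / 2)) + Sum₂ (splittingsℕ (n / 2)) (f ∘ suc))
    ≡⟨ cong₂ _*_ (sym (even-2+n n)) (trans (sym (Σ-splittingsℕ f (n / 2)))
         (cong (λ k → Sum₂ (splittingsℕ k) f) (sym (2+n/2 n)))) ⟩
  even (suc (suc n)) * Sum₂ (splittingsℕ (suc (suc n) / 2)) f ∎
  where
  F : ℕ → ℕ → ℚ
  F a b = (even a * even b) * f (a / 2) (b / 2)
  collect : ∀ p q r u v → (1ℚ * p) * q + ((0ℚ * r) * u + p * v) ≡ p * (q + v)
  collect = solve-∀ ℚ-ring

-- The coefficients of 1 - t².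
linear∘half : ℕ → ℚ
linear∘half n = even n * linear (- 1ℚ) (n / 2)

linear∘half-3+n : ∀ n → linear∘half (suc (suc (suc n))) ≡ 0ℚ
linear∘half-3+n zero    = refl
linear∘half-3+n (suc n) = trans
  (cong (λ k → even (4 ℕ.+ n) * linear (- 1ℚ) k) (trans (2+n/2 (2 ℕ.+ n)) (cong suc (2+n/2 n))))
  (*-zeroʳ (even (4 ℕ.+ n)))

-- (1 - t²) / (1 - t) = 1 + t

one⋆linear∘half : ∀ n → convolution splittingsℕ one linear∘half n ≡ linear 1ℚ n
one⋆linear∘half zero                = refl
one⋆linear∘half (suc zero)          = refl
one⋆linear∘half (suc (suc zero))    = refl
one⋆linear∘half (suc (suc (suc n))) = trans (one-convolution linear∘half (suc (suc n)))
  (cong₂ _+_ (linear∘half-3+n n) (one⋆linear∘half (suc (suc n))))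

-- Coefficients of the series

-1^-sumAt : ∀ {A : Set} (f : A → ℕ) xs → -1^ sumAt (λ _ → f) xs ≡ prod (λ x → -1^ f x) xs
-1^-sumAt f []       = refl
-1^-sumAt f (x ∷ xs) = trans (-1^-+ (f x) _) (cong (-1^ f x *_) (-1^-sumAt f xs))

𝟙-+≟0 : ∀ m n → 𝟙 (m ℕ.+ n ≟ 0) ≡ 𝟙 (m ≟ 0) * 𝟙 (n ≟ 0)
𝟙-+≟0 zero    n = sym (*-identityˡ (𝟙 (n ≟ 0)))
𝟙-+≟0 (suc m) n = sym (*-zeroˡ (𝟙 (n ≟ 0)))

prod-≟0 : ∀ {A : Set} {δ : A → ℚ} (deg : ℕ → A → ℕ) → (∀ i x → δ x ≡ 𝟙 (deg i x ≟ 0)) →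
          ∀ xs → prod δ xs ≡ 𝟙 (sumAt deg xs ≟ 0)
prod-≟0 deg e []       = refl
prod-≟0 deg e (x ∷ xs) = trans (cong₂ _*_ (e 0 x) (prod-≟0 (deg ∘ suc) (e ∘ suc) xs))
                               (sym (𝟙-+≟0 (deg 0 x) _))

𝟙-all-at? : ∀ {A : Set} (z : A) {P : A → Set} (P? : ∀ x → Dec (P x)) (pz : P z) xs →
            𝟙 (all-at? z {P} P? pz xs) ≡ prod (λ x → 𝟙 (P? x)) xs
𝟙-all-at? z P? pz []       = refl
𝟙-all-at? z P? pz (x ∷ xs) = trans (bit-∧ (does (P? x)) _) (cong (𝟙 (P? x) *_) (𝟙-all-at? z P? pz xs))

𝟙-≋[] : ∀ {A : Set} (_~_ : A → A → Set) (~-refl : ∀ {x} → x ~ x) (z : A)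
        (_~?_ : ∀ x y → Dec (x ~ y)) xs →
        𝟙 (Padded.≋-dec _~_ ~-refl z _~?_ xs []) ≡ prod (λ x → 𝟙 (x ~? z)) xs
𝟙-≋[] _~_ ~-refl z _~?_ []       = refl
𝟙-≋[] _~_ ~-refl z _~?_ (x ∷ xs) =
  trans (bit-∧ (does (x ~? z)) _) (cong (𝟙 (x ~? z) *_) (𝟙-≋[] _~_ ~-refl z _~?_ xs))

infixl 7 _⋆_

_⋆_ : (Monomial → ℚ) → (Monomial → ℚ) → Monomial → ℚ
_⋆_ = convolution splittings

multiplicative : (ℕ → ℚ) → Monomial → ℚ
multiplicative φ = prod (prod φ)

multiplicative-cong : ∀ {φ ψ} → (∀ n → φ n ≡ ψ n) → ∀ m → multiplicative φ m ≡ multiplicative ψ m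
multiplicative-cong e = prod-cong (prod-cong e)

multiplicative-* : ∀ φ ψ m → multiplicative φ m * multiplicative ψ m ≡
                   multiplicative (λ n → φ n * ψ n) m
multiplicative-* φ ψ m = trans (prod-* (prod φ) (prod ψ) m) (prod-cong (prod-* φ ψ) m)

multiplicative-⋆ : ∀ φ ψ χ → (∀ n → convolution splittingsℕ φ ψ n ≡ χ n) →
                   ∀ m → (multiplicative φ ⋆ multiplicative ψ) m ≡ multiplicative χ m
multiplicative-⋆ φ ψ χ e =
  convolution-prod (splittingsList splittingsℕ) (prod φ) (prod ψ) (prod χ)
    (convolution-prod splittingsℕ φ ψ χ e)

δ h e e⁺ evens : Monomial → ℚ
δ     = multiplicative δ₀
h     = multiplicative one
e     = multiplicative (linear (- 1ℚ))
e⁺    = multiplicative (linear 1ℚ)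
evens = multiplicative even

-- The coefficients of ∑ P_d: p is i on the positive powers of x_{i,j}, and 0 elsewhere.

rowDerivation : ℕ → List ℕ → ℚ
rowDerivation i = derivation δ₀ (λ j n → fromℕ (suc i) * positive n)

p : Monomial → ℚ
p = derivation (prod δ₀) rowDerivation

h≡1 : ∀ m → h m ≡ 1ℚ
h≡1 = prod-1 (prod-1 (λ _ → refl))

δ≡𝟙degree : ∀ m → δ m ≡ 𝟙 (degree m ≟ 0)
δ≡𝟙degree = prod-≟0 (λ i → sumAt (λ j n → suc i ℕ.* n))
  (λ i → prod-≟0 (λ j n → suc i ℕ.* n) (λ j n → element i n))
  where
  element : ∀ i n → δ₀ n ≡ 𝟙 (suc i ℕ.* n ≟ 0)
  element i zero    rewrite ℕ.*-zeroʳ i = refl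
  element i (suc n) = refl

graded : Graded splittings degree
graded = graded-list (splittingsList splittingsℕ) _
  (λ i → graded-list splittingsℕ _ (λ j → graded-ℕ (suc i)))

coassociative : Coassociative splittings
coassociative = coassociative-list _ (coassociative-list _ coassociative-ℕ)

⋆-identityˡ : ∀ φ m → (δ ⋆ φ) m ≡ φ m
⋆-identityˡ = counitˡ-list _ (counitˡ-list _ counitˡ-ℕ)

⋆-identityʳ : ∀ φ m → (φ ⋆ δ) m ≡ φ m
⋆-identityʳ = counitʳ-list _ (counitʳ-list _ counitʳ-ℕ)

⋆-cong : ∀ {f f′ g g′} → (∀ m → f m ≡ f′ m) → (∀ m → g m ≡ g′ m) → ∀ m → (f ⋆ g) m ≡ (f′ ⋆ g′) m
⋆-cong e₁ e₂ m = Σ-cong (splittings m) (λ (a , b) → cong₂ _*_ (e₁ a) (e₂ b))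

⋆-assoc : ∀ f g k m → ((f ⋆ g) ⋆ k) m ≡ (f ⋆ (g ⋆ k)) m
⋆-assoc f g k m = begin
  Σ[ u , c ← splittings m ] ((f ⋆ g) u * k c)
    ≡⟨ Σ-cong (splittings m) (λ (u , c) → sym (Σ-*ʳ (k c) _ (splittings u))) ⟩
  Σ[ u , c ← splittings m ] Σ[ a , b ← splittings u ] ((f a * g b) * k c)
    ≡⟨ coassociative (λ a b c → (f a * g b) * k c) m ⟩
  Σ[ a , v ← splittings m ] Σ[ b , c ← splittings v ] ((f a * g b) * k c)
    ≡⟨ Σ-cong (splittings m) (λ (a , v) → trans
         (Σ-cong (splittings v) (λ (b , c) → *-assoc (f a) (g b) (k c)))
         (Σ-*ˡ (f a) _ (splittings v))) ⟩
  Σ[ a , v ← splittings m ] (f a * (g ⋆ k) v) ∎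

dilatable : Dilatable splittings evens (root 2)
dilatable = dilatable-list _ (dilatable-list _ dilatable-ℕ)

dilated : (Monomial → ℚ) → Monomial → ℚ
dilated f m = evens m * f (root 2 m)

dilated-⋆ : ∀ f g m → (dilated f ⋆ dilated g) m ≡ dilated (f ⋆ g) m
dilated-⋆ f g m = trans
  (Σ-cong (splittings m) (λ (a , b) → *-interchange (evens a) (f (root 2 a)) (evens b) (g (root 2 b))))
  (dilatable (λ a b → f a * g b) m)

dilated-e : ∀ m → dilated e m ≡ multiplicative linear∘half m
dilated-e m = begin
  evens m * e (root 2 m)
    ≡⟨ cong (evens m *_) (trans (prod-map (prod (linear (- 1ℚ))) (map (_/ 2)) m)
         (prod-cong (prod-map (linear (- 1ℚ)) (_/ 2)) m)) ⟩
  evens m * multiplicative (λ n → linear (- 1ℚ) (n / 2)) m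
    ≡⟨ multiplicative-* even (λ n → linear (- 1ℚ) (n / 2)) m ⟩
  multiplicative linear∘half m ∎

e⋆h : ∀ m → (e ⋆ h) m ≡ δ m
e⋆h = multiplicative-⋆ (linear (- 1ℚ)) one δ₀ linear⋆one

h⋆e : ∀ m → (h ⋆ e) m ≡ δ m
h⋆e = multiplicative-⋆ one (linear (- 1ℚ)) δ₀ one⋆linear

h⋆dilated-e : ∀ m → (h ⋆ dilated e) m ≡ e⁺ m
h⋆dilated-e m = trans (⋆-cong {f = h} (λ _ → refl) dilated-e m)
  (multiplicative-⋆ one linear∘half (linear 1ℚ) one⋆linear∘half m)

-- The Leibniz rule is applied twice, within a row and across rows. The weight `suc i` in `p` turns
-- exponents into degrees.
p⋆multiplicative : ∀ c φ → (∀ n → convolution splittingsℕ positive φ n ≡ (c * fromℕ n) * φ n) →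
                   ∀ m → (p ⋆ multiplicative φ) m ≡ (c * fromℕ (degree m)) * multiplicative φ m
p⋆multiplicative c φ eq = convolution-derivation _ c (prod δ₀) (prod φ)
  (counitˡ-list _ counitˡ-ℕ) rowDerivation (λ i → sumAt (λ j n → suc i ℕ.* n))
  (λ i → convolution-derivation splittingsℕ c δ₀ φ counitˡ-ℕ _ (λ j n → suc i ℕ.* n) (λ j → element i))
  where
  rearrange : ∀ w c n q → w * ((c * n) * q) ≡ (c * (w * n)) * q
  rearrange = solve-∀ ℚ-ring
  element : ∀ i n → convolution splittingsℕ (λ k → fromℕ (suc i) * positive k) φ n ≡
            (c * fromℕ (suc i ℕ.* n)) * φ n
  element i n = begin
    convolution splittingsℕ (λ k → fromℕ (suc i) * positive k) φ n
      ≡⟨ Σ-cong (splittingsℕ n) (λ (a , b) → *-assoc (fromℕ (suc i)) (positive a) (φ b)) ⟩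
    Σ[ a , b ← splittingsℕ n ] (fromℕ (suc i) * (positive a * φ b))
      ≡⟨ Σ-*ˡ (fromℕ (suc i)) _ (splittingsℕ n) ⟩
    fromℕ (suc i) * convolution splittingsℕ positive φ n
      ≡⟨ cong (fromℕ (suc i) *_) (eq n) ⟩
    fromℕ (suc i) * ((c * fromℕ n) * φ n)
      ≡⟨ rearrange (fromℕ (suc i)) c (fromℕ n) (φ n) ⟩
    (c * (fromℕ (suc i) * fromℕ n)) * φ n
      ≡⟨ cong (λ k → (c * k) * φ n) (sym (fromℕ-* (suc i) n)) ⟩
    (c * fromℕ (suc i ℕ.* n)) * φ n ∎

p⋆h : ∀ m → (p ⋆ h) m ≡ (1ℚ * fromℕ (degree m)) * h m
p⋆h = p⋆multiplicative 1ℚ one positive⋆one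

p⋆e : ∀ m → (p ⋆ e) m ≡ (- 1ℚ * fromℕ (degree m)) * e m
p⋆e = p⋆multiplicative (- 1ℚ) (linear (- 1ℚ)) positive⋆linear

coeff-1ₛ : ∀ m → coeff 1ₛ m ≡ δ m
coeff-1ₛ m = trans (𝟙-≋[] _ _ _ _ m) (prod-cong (𝟙-≋[] _≡_ refl 0 _≟_) m)

coeff-H : ∀ d m → coeff (H d) m ≡ 𝟙 (degree m ≟ d) * h m
coeff-H d m = trans (bit-* (does (degree m ≟ d)) 1ℚ) (cong (𝟙 (degree m ≟ d) *_) (sym (h≡1 m)))

𝟙-squareFree : ∀ d m → 𝟙 (squareFreeOfDegree? d m) ≡
               𝟙 (degree m ≟ d) * multiplicative (λ n → 𝟙 (n ℕ.≤? 1)) m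
𝟙-squareFree d m = begin
  𝟙 (squareFreeOfDegree? d m)
    ≡⟨ bit-∧ _ (does (degree m ≟ d)) ⟩
  𝟙 (all-at? [] (all-at? 0 (ℕ._≤? 1) z≤n) (λ j → z≤n) m) * 𝟙 (degree m ≟ d)
    ≡⟨ *-comm _ (𝟙 (degree m ≟ d)) ⟩
  𝟙 (degree m ≟ d) * 𝟙 (all-at? [] (all-at? 0 (ℕ._≤? 1) z≤n) (λ j → z≤n) m)
    ≡⟨ cong (𝟙 (degree m ≟ d) *_) (trans
         (𝟙-all-at? [] (all-at? 0 (ℕ._≤? 1) z≤n) (λ j → z≤n) m)
         (prod-cong (𝟙-all-at? 0 (ℕ._≤? 1) z≤n) m)) ⟩
  𝟙 (degree m ≟ d) * multiplicative (λ n → 𝟙 (n ℕ.≤? 1)) m ∎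

coeff-E⁺ : ∀ d m → coeff (E⁺ d) m ≡ 𝟙 (degree m ≟ d) * e⁺ m
coeff-E⁺ d m = trans (𝟙-squareFree d m)
  (cong (𝟙 (degree m ≟ d) *_) (multiplicative-cong
    (λ { zero → refl ; (suc zero) → refl ; (suc (suc n)) → refl }) m))

coeff-E : ∀ d m → coeff (E d) m ≡ 𝟙 (degree m ≟ d) * e m
coeff-E d m = begin
  coeff (E d) m
    ≡⟨ bit-* _ (-1^ #indeterminates m) ⟩
  𝟙 (squareFreeOfDegree? d m) * -1^ #indeterminates m
    ≡⟨ cong₂ _*_ (𝟙-squareFree d m)
         (trans (-1^-sumAt (sumAt (λ j → 1 ℕ.⊓_)) m) (prod-cong (-1^-sumAt (1 ℕ.⊓_)) m)) ⟩
  (𝟙 (degree m ≟ d) * multiplicative (λ n → 𝟙 (n ℕ.≤? 1)) m) * multiplicative (λ n → -1^ (1 ℕ.⊓ n)) m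
    ≡⟨ *-assoc (𝟙 (degree m ≟ d)) _ _ ⟩
  𝟙 (degree m ≟ d) * (multiplicative (λ n → 𝟙 (n ℕ.≤? 1)) m * multiplicative (λ n → -1^ (1 ℕ.⊓ n)) m)
    ≡⟨ cong (𝟙 (degree m ≟ d) *_) (trans (multiplicative-* _ _ m) (multiplicative-cong
         (λ { zero → refl ; (suc zero) → refl ; (suc (suc n)) → refl }) m)) ⟩
  𝟙 (degree m ≟ d) * e m ∎

coeff-dilate-2 : ∀ F m → coeff (dilate 2 F) m ≡ dilated (coeff F) m
coeff-dilate-2 F m = trans (bit-* _ (coeff F (root 2 m)))
  (cong (_* coeff F (root 2 m)) (trans (𝟙-all-at? [] _ _ m) (prod-cong (𝟙-all-at? 0 _ _) m)))

-- Support and values of `p`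

module _ {A : Set} (_~_ : A → A → Set) (~-refl : ∀ {x} → x ~ x) (z : A) (δ : A → ℚ) where
  open Padded _~_ ~-refl z

  -- This and `Concentrated` are stated up to `_~_` so that they apply to rows as well as to
  -- exponents, rows being compared only up to trailing zeros.
  Trivial : (ℕ → A → ℚ) → Set
  Trivial q = ∀ n x → x ~ z → δ x ≡ 1ℚ × q n x ≡ 0ℚ

  Concentrated : A → (ℕ → A → ℚ) → (ℕ → ℚ) → Set
  Concentrated y q c = ∀ n x → x ~ y → δ x ≡ 0ℚ × q n x ≡ c n

  trivial-list : ∀ {q} → Trivial q → ∀ xs → xs ≋ [] → prod δ xs ≡ 1ℚ × derivation δ q xs ≡ 0ℚ
  trivial-list             tr []       eq = refl , refl
  trivial-list {q} tr (x ∷ xs) eq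
    with tr 0 x (eq 0) | trivial-list {q ∘ suc} (λ n → tr (suc n)) xs (eq ∘ suc)
  ... | δx , qx | δxs , qxs rewrite δx | qx | δxs | qxs = refl , refl

  -- The value of `prod δ` is carried along because these lists become entries at the next level,
  -- where `Concentrated` asks for it.
  concentrated-list : ∀ {y q c} → ¬ (z ~ y) → Trivial q → Concentrated y q c →
                      ∀ i xs → xs ≋ single z i y → prod δ xs ≡ 0ℚ × derivation δ q xs ≡ c i
  concentrated-list {y} z≁y tr co i       []       eq =
    contradiction (subst (z ~_) (at-single z i y) (eq i)) z≁y
  concentrated-list {q = q} {c} z≁y tr co zero    (x ∷ xs) eq
    with co 0 x (eq 0) | trivial-list {q ∘ suc} (λ n → tr (suc n)) xs (eq ∘ suc)
  ... | δx , qx | δxs , qxs rewrite δx | qx | δxs | qxs = refl , unit (c 0)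
    where
    unit : ∀ r → r * 1ℚ + 0ℚ * 0ℚ ≡ r
    unit = solve-∀ ℚ-ring
  concentrated-list {q = q} {c} z≁y tr co (suc i) (x ∷ xs) eq
    with tr 0 x (eq 0)
       | concentrated-list {q = q ∘ suc} {c ∘ suc} z≁y (λ n → tr (suc n)) (λ n → co (suc n)) i xs (eq ∘ suc)
  ... | δx , qx | δxs , qxs rewrite δx | qx | δxs | qxs = refl , unit (c (suc i))
    where
    unit : ∀ r → 0ℚ * 0ℚ + 1ℚ * r ≡ r
    unit = solve-∀ ℚ-ring

  module _ (Pure : A → Set) (z≁pure : ∀ y → Pure y → ¬ (z ~ y)) where

    -- Each summand of the derivation contains `δ` at all entries but one, so two pure entries
    -- annihilate all of them, as does one entry where both `δ` and `q` vanish.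
    classify-list : ∀ {q c} → Trivial q → (∀ y → Pure y → Concentrated y q c) →
      (∀ n x → x ~ z ⊎ Pure x ⊎ (δ x ≡ 0ℚ × q n x ≡ 0ℚ)) →
      ∀ xs → xs ≋ [] ⊎ (∃₂ λ i y → Pure y × xs ≋ single z i y) ⊎
             (prod δ xs ≡ 0ℚ × derivation δ q xs ≡ 0ℚ)
    classify-list tr co cl []       = inj₁ (λ _ → ~-refl)
    classify-list {q} {c} tr co cl (x ∷ xs)
      with cl 0 x | classify-list {q ∘ suc} {c ∘ suc} (λ n → tr (suc n))
                      (λ y py n → co y py (suc n)) (λ n → cl (suc n)) xs
    ... | inj₁ x~z | inj₁ eq = inj₁ (λ { zero → x~z ; (suc n) → eq n })
    ... | inj₁ x~z | inj₂ (inj₁ (i , y , py , eq)) =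
      inj₂ (inj₁ (suc i , y , py , λ { zero → x~z ; (suc n) → eq n }))
    ... | inj₁ x~z | inj₂ (inj₂ (δxs , qxs)) rewrite δxs | qxs =
      inj₂ (inj₂ (*-zeroʳ (δ x) , cong₂ _+_ (*-zeroʳ (q 0 x)) (*-zeroʳ (δ x))))
    ... | inj₂ (inj₁ px) | inj₁ eq = inj₂ (inj₁ (0 , x , px , λ { zero → ~-refl ; (suc n) → eq n }))
    ... | inj₂ (inj₁ px) | inj₂ (inj₁ (i , y , py , eq))
      rewrite proj₁ (co x px 0 x ~-refl)
            | proj₁ (concentrated-list {q = q ∘ suc} {c ∘ suc} (z≁pure y py) (λ n → tr (suc n))
                      (λ n → co y py (suc n)) i xs eq) =
      inj₂ (inj₂ (refl , cong₂ _+_ (*-zeroʳ (q 0 x)) (*-zeroˡ (derivation δ (q ∘ suc) xs))))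
    ... | inj₂ (inj₁ px) | inj₂ (inj₂ (δxs , qxs)) rewrite δxs | qxs =
      inj₂ (inj₂ (*-zeroʳ (δ x) , cong₂ _+_ (*-zeroʳ (q 0 x)) (*-zeroʳ (δ x))))
    ... | inj₂ (inj₂ (δx , qx)) | _ rewrite δx | qx =
      inj₂ (inj₂ (*-zeroˡ (prod δ xs) ,
        cong₂ _+_ (*-zeroˡ (prod δ xs)) (*-zeroˡ (derivation δ (q ∘ suc) xs))))

infix 4 _≋ᵣ_

_≋ᵣ_ : List ℕ → List ℕ → Set
r ≋ᵣ r′ = ∀ j → at 0 r j ≡ at 0 r′ j

PureRow : List ℕ → Set
PureRow r = ∃₂ λ j k → r ≋ᵣ single 0 j (suc k)

PurePower : Monomial → Set
PurePower m = ∃ λ i → ∃₂ λ j k → m ≈ᵐ power i j (suc k)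

rowValue : ℕ → ℕ → ℕ → ℚ
rowValue i j n = fromℕ (suc i) * positive n

trivial-ℕ : ∀ i → Trivial _≡_ refl 0 δ₀ (rowValue i)
trivial-ℕ i j .0 refl = refl , *-zeroʳ (fromℕ (suc i))

concentrated-ℕ : ∀ i k → Concentrated _≡_ refl 0 δ₀ (suc k) (rowValue i) (λ _ → fromℕ (suc i))
concentrated-ℕ i k j ._ refl = refl , *-identityʳ (fromℕ (suc i))

trivial-row : Trivial _≋ᵣ_ (λ _ → refl) [] (prod δ₀) rowDerivation
trivial-row i = trivial-list _≡_ refl 0 δ₀ (trivial-ℕ i)

concentrated-row : ∀ y → PureRow y →
  Concentrated _≋ᵣ_ (λ _ → refl) [] (prod δ₀) y rowDerivation (λ i → fromℕ (suc i))
concentrated-row y (j , k , y≋) i x x≋y =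
  concentrated-list _≡_ refl 0 δ₀ {suc k} {rowValue i} {λ _ → fromℕ (suc i)} (λ ())
    (trivial-ℕ i) (concentrated-ℕ i k) j x (λ n → trans (x≋y n) (y≋ n))

pureRow-nontrivial : ∀ y → PureRow y → ¬ ([] ≋ᵣ y)
pureRow-nontrivial y (j , k , y≋) eq =
  contradiction (trans (eq j) (trans (y≋ j) (at-single 0 j (suc k)))) (λ ())

classify-row : ∀ i r → r ≋ᵣ [] ⊎ PureRow r ⊎ (prod δ₀ r ≡ 0ℚ × rowDerivation i r ≡ 0ℚ)
classify-row i r with classify-list _≡_ refl 0 δ₀ (λ x → ∃ λ k → x ≡ suc k) (λ { ._ (k , refl) () })
  {rowValue i} {λ _ → fromℕ (suc i)} (trivial-ℕ i) (λ { ._ (k , refl) → concentrated-ℕ i k })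
  (λ { _ zero → inj₁ refl ; _ (suc k) → inj₂ (inj₁ (k , refl)) }) r
... | inj₁ eq                              = inj₁ eq
... | inj₂ (inj₁ (j , ._ , (k , refl) , eq)) = inj₂ (inj₁ (j , k , eq))
... | inj₂ (inj₂ eqs)                      = inj₂ (inj₂ eqs)

p-power : ∀ {m} i j k → m ≈ᵐ power i j (suc k) → p m ≡ fromℕ (suc i)
p-power {m} i j k eq = proj₂ (concentrated-list _≋ᵣ_ (λ _ → refl) [] (prod δ₀)
  {single 0 j (suc k)} {rowDerivation} {λ i → fromℕ (suc i)}
  (pureRow-nontrivial (single 0 j (suc k)) (j , k , λ _ → refl)) trivial-row
  (concentrated-row (single 0 j (suc k)) (j , k , λ _ → refl)) i m eq)

purePower⊎p≡0 : ∀ m → PurePower m ⊎ p m ≡ 0ℚ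
purePower⊎p≡0 m with classify-list _≋ᵣ_ (λ _ → refl) [] (prod δ₀) PureRow pureRow-nontrivial
  {rowDerivation} {λ i → fromℕ (suc i)} trivial-row concentrated-row classify-row m
... | inj₁ eq = inj₂ (proj₂ (trivial-list _≋ᵣ_ (λ _ → refl) [] (prod δ₀) {rowDerivation} trivial-row m eq))
... | inj₂ (inj₁ (i , y , (j , k , y≋) , eq)) = inj₁ (i , j , k , λ i′ j′ → trans (eq i′ j′) (single-cong i i′ j′))
  where
  single-cong : ∀ i i′ j′ → at 0 (at [] (single [] i y) i′) j′ ≡
                at 0 (at [] (single [] i (single 0 j (suc k))) i′) j′
  single-cong zero    zero     j′ = y≋ j′
  single-cong zero    (suc i′) j′ = refl
  single-cong (suc i) zero     j′ = refl
  single-cong (suc i) (suc i′) j′ = single-cong i i′ j′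
... | inj₂ (inj₂ (_ , eq)) = inj₂ eq

-- The coefficients of `P d`

Σ-filter : ∀ {A : Set} {Q : A → Set} (Q? : ∀ x → Dec (Q x)) (f : A → ℚ) xs →
           Σ[ x ← filter Q? xs ] f x ≡ Σ[ x ← xs ] (𝟙 (Q? x) * f x)
Σ-filter Q? f []       = refl
Σ-filter Q? f (x ∷ xs) with does (Q? x)
... | true  = cong₂ _+_ (sym (*-identityˡ (f x))) (Σ-filter Q? f xs)
... | false = trans (Σ-filter Q? f xs) (trans (sym (+-identityˡ _))
                (cong (_+ Σ[ y ← xs ] (𝟙 (Q? y) * f y)) (sym (*-zeroˡ (f x)))))

Σ-upTo : ∀ (f : ℕ → ℚ) n → Σ[ i ← upTo (suc n) ] f i ≡ f 0 + Σ[ i ← upTo n ] f (suc i)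
Σ-upTo f n = cong (f 0 +_) (trans (cong (λ is → Sum is f) (sym (map-upTo suc n))) (Σ-map f suc (upTo n)))

Σ-upTo-𝟙 : ∀ (f : ℕ → ℚ) k n → Σ[ i ← upTo n ] (𝟙 (k ≟ i) * f i) ≡ 𝟙 (k ℕ.<? n) * f k
Σ-upTo-𝟙 f k zero = sym (*-zeroˡ (f k))
Σ-upTo-𝟙 f zero (suc n) = begin
  Σ[ i ← upTo (suc n) ] (𝟙 (0 ≟ i) * f i)
    ≡⟨ Σ-upTo (λ i → 𝟙 (0 ≟ i) * f i) n ⟩
  1ℚ * f 0 + Σ[ i ← upTo n ] (0ℚ * f (suc i))
    ≡⟨ cong (1ℚ * f 0 +_) (trans (Σ-cong (upTo n) (λ i → *-zeroˡ (f (suc i)))) (Σ-0 (upTo n))) ⟩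
  1ℚ * f 0 + 0ℚ
    ≡⟨ +-identityʳ (1ℚ * f 0) ⟩
  1ℚ * f 0 ∎
Σ-upTo-𝟙 f (suc k) (suc n) = begin
  Σ[ i ← upTo (suc n) ] (𝟙 (suc k ≟ i) * f i)
    ≡⟨ Σ-upTo (λ i → 𝟙 (suc k ≟ i) * f i) n ⟩
  0ℚ * f 0 + Σ[ i ← upTo n ] (𝟙 (k ≟ i) * f (suc i))
    ≡⟨ cong₂ _+_ (*-zeroˡ (f 0)) (Σ-upTo-𝟙 (f ∘ suc) k n) ⟩
  0ℚ + 𝟙 (k ℕ.<? n) * f (suc k)
    ≡⟨ +-identityˡ (𝟙 (k ℕ.<? n) * f (suc k)) ⟩
  𝟙 (suc k ℕ.<? suc n) * f (suc k) ∎

sumAt-single : ∀ {A : Set} (f : ℕ → A → ℕ) z n x → (∀ i → f i z ≡ 0) → sumAt f (single z n x) ≡ f n x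
sumAt-single f z zero    x fz = ℕ.+-identityʳ (f 0 x)
sumAt-single f z (suc n) x fz = cong₂ ℕ._+_ (fz 0) (sumAt-single (f ∘ suc) z n x (fz ∘ suc))

degree-power : ∀ {m} i j k → m ≈ᵐ power i j k → degree m ≡ suc i ℕ.* k
degree-power {m} i j k eq = trans (degree-cong {m} {power i j k} eq)
  (trans (sumAt-single (λ i → sumAt (λ j n → suc i ℕ.* n)) [] i (single 0 j k) (λ _ → refl))
         (sumAt-single (λ j n → suc i ℕ.* n) 0 j k (λ _ → ℕ.*-zeroʳ (suc i))))

at-single-≢ : ∀ {A : Set} (z : A) n x {k} → k ≢ n → at z (single z n x) k ≡ z
at-single-≢ z zero    x {zero}  k≢n = contradiction refl k≢n
at-single-≢ z zero    x {suc k} k≢n = refl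
at-single-≢ z (suc n) x {zero}  k≢n = refl
at-single-≢ z (suc n) x {suc k} k≢n = at-single-≢ z n x (k≢n ∘ cong suc)

-- The exponent `suc k` is positive, so row `i` of `m` is nonzero, and a power in row `i′` is zero
-- in all other rows.
power-row : ∀ {m} i j k i′ j′ l → m ≈ᵐ power i j (suc k) → m ≈ᵐ power i′ j′ l → i ≡ i′
power-row {m} i j k i′ j′ l eq eq′ with i ≟ i′
... | yes i≡i′ = i≡i′
... | no  i≢i′ = contradiction (begin
  suc k                                 ≡⟨ sym (at-single 0 j (suc k)) ⟩
  at 0 (single 0 j (suc k)) j           ≡⟨ cong (λ r → at 0 r j) (sym (at-single [] i (single 0 j (suc k)))) ⟩
  exponent (power i j (suc k)) i j      ≡⟨ sym (eq i j) ⟩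
  exponent m i j                        ≡⟨ eq′ i j ⟩
  exponent (power i′ j′ l) i j          ≡⟨ cong (λ r → at 0 r j) (at-single-≢ [] i′ (single 0 j′ l) i≢i′) ⟩
  0                                     ∎) (λ ())

powerInRow⇒degree : ∀ d i m → suc i ∣ d → PowerInRow i (d / suc i) m → degree m ≡ d
powerInRow⇒degree d i m i∣d (j , eq) = trans (degree-power {m} i j (d / suc i) eq) (m*[n/m]≡n i∣d)

powerInRow⇒pure : ∀ d i m → suc i ∣ suc d → PowerInRow i (suc d / suc i) m → PurePower m
powerInRow⇒pure d i m i∣d (j , eq) with suc d / suc i | m*[n/m]≡n i∣d
... | zero  | q = contradiction (trans (sym (ℕ.*-zeroʳ (suc i))) q) (λ ())
... | suc k | _ = i , j , k , eq

-- At a power, of degree `suc d`, of an indeterminate in row `i`, only the summand of that row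
-- survives, with value `suc i`. At all other monomials both sides vanish.
coeff-P : ∀ d m → coeff (P (suc d)) m ≡ 𝟙 (degree m ≟ suc d) * p m
coeff-P d m = trans (Σ-filter (λ i → suc i ∣? suc d) _ (upTo (suc d))) (by-cases (degree m ≟ suc d))
  where
  D : ℕ
  D = suc d
  term : ℕ → ℚ
  term i = 𝟙 (suc i ∣? D) * (fromℕ (suc i) * 𝟙 (powerInRow? i (D / suc i) m))

  term≡0 : ∀ i → (suc i ∣ D → ¬ PowerInRow i (D / suc i) m) → term i ≡ 0ℚ
  term≡0 i imp = split (suc i ∣? D)
    where
    c : ℚ
    c = fromℕ (suc i)
    split : (i∣?D : Dec (suc i ∣ D)) → 𝟙 i∣?D * (c * 𝟙 (powerInRow? i (D / suc i) m)) ≡ 0ℚ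
    split (no  _)   = *-zeroˡ (c * 𝟙 (powerInRow? i (D / suc i) m))
    split (yes i∣D) = trans
      (cong (λ q → 1ℚ * (c * q)) (𝟙-no (powerInRow? i (D / suc i) m) (imp i∣D)))
      (trans (*-identityˡ (c * 0ℚ)) (*-zeroʳ c))

  all-0 : (∀ i → suc i ∣ D → ¬ PowerInRow i (D / suc i) m) → Σ[ i ← upTo D ] term i ≡ 0ℚ
  all-0 imp = trans (Σ-cong (upTo D) (λ i → term≡0 i (imp i))) (Σ-0 (upTo D))

  single-term : ∀ i j k → m ≈ᵐ power i j (suc k) → degree m ≡ D →
                ∀ i′ → term i′ ≡ 𝟙 (i ≟ i′) * fromℕ (suc i′)
  single-term i j k eq deg i′ = split (i ≟ i′)
    where
    D≡ : suc i ℕ.* suc k ≡ D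
    D≡ = trans (sym (degree-power {m} i j (suc k) eq)) deg
    i∣D : suc i ∣ D
    i∣D = subst (suc i ∣_) D≡ (m∣m*n (suc k))
    eq″ : m ≈ᵐ power i j (D / suc i)
    eq″ = subst (λ e → m ≈ᵐ power i j e)
            (trans (sym (m*n/n≡m (suc k) (suc i))) (cong (_/ suc i) (trans (ℕ.*-comm (suc k) (suc i)) D≡))) eq
    split : (i≟i′ : Dec (i ≡ i′)) → term i′ ≡ 𝟙 i≟i′ * fromℕ (suc i′)
    split (no i≢i′) = trans
      (term≡0 i′ (λ _ (j′ , eq′) → i≢i′ (power-row {m} i j k i′ j′ (D / suc i′) eq eq′)))
      (sym (*-zeroˡ (fromℕ (suc i′))))
    split (yes refl) = begin
      𝟙 (suc i ∣? D) * (fromℕ (suc i) * 𝟙 (powerInRow? i (D / suc i) m))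
        ≡⟨ cong₂ (λ q r → q * (fromℕ (suc i) * r))
             (𝟙-yes (suc i ∣? D) i∣D) (𝟙-yes (powerInRow? i (D / suc i) m) (j , eq″)) ⟩
      1ℚ * (fromℕ (suc i) * 1ℚ)
        ≡⟨ cong (1ℚ *_) (*-identityʳ (fromℕ (suc i))) ⟩
      1ℚ * fromℕ (suc i) ∎

  by-cases : (deg? : Dec (degree m ≡ D)) → Σ[ i ← upTo D ] term i ≡ 𝟙 deg? * p m
  by-cases (no ¬deg) = trans (all-0 (λ i i∣D r → ¬deg (powerInRow⇒degree D i m i∣D r)))
                             (sym (*-zeroˡ (p m)))
  by-cases (yes deg) with purePower⊎p≡0 m
  ... | inj₂ p≡0 = trans
    (all-0 (λ i i∣D r → not-pure (powerInRow⇒pure d i m i∣D r)))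
    (sym (trans (*-identityˡ (p m)) p≡0))
    where
    not-pure : ¬ PurePower m
    not-pure (i , j , k , eq) = fromℕ-suc≢0 i (trans (sym (p-power {m} i j k eq)) p≡0)
  ... | inj₁ (i , j , k , eq) = begin
    Σ[ i′ ← upTo D ] term i′
      ≡⟨ Σ-cong (upTo D) (single-term i j k eq deg) ⟩
    Σ[ i′ ← upTo D ] (𝟙 (i ≟ i′) * fromℕ (suc i′))
      ≡⟨ Σ-upTo-𝟙 (fromℕ ∘ suc) i D ⟩
    𝟙 (i ℕ.<? D) * fromℕ (suc i)
      ≡⟨ cong₂ _*_ (𝟙-yes (i ℕ.<? D) i<D) (sym (p-power {m} i j k eq)) ⟩
    1ℚ * p m ∎
    where
    i<D : i < D
    i<D = subst (suc i ≤_) (trans (sym (degree-power {m} i j (suc k) eq)) deg) (ℕ.m≤m*n (suc i) (suc k))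

-- Sums over compositions

-- Truncated subtraction alone would accept `l = 0` for every `k > n`; the bound on `k` excludes
-- this.
𝟙-complement : ∀ k n l → 𝟙 (k ℕ.<? suc n) * 𝟙 (l ≟ n ℕ.∸ k) ≡ 𝟙 (k ℕ.+ l ≟ n)
𝟙-complement zero    n       l = *-identityˡ (𝟙 (l ≟ n))
𝟙-complement (suc k) zero    l = *-zeroˡ (𝟙 (l ≟ 0))
𝟙-complement (suc k) (suc n) l = 𝟙-complement k n l

-- Here `suc i` runs over the sizes of a first part, and `k`, `l` are the degrees of two pieces of a
-- monomial. Only `suc i = k` survives, the two degree conditions merge into one on the total, and
-- `positive k` records that parts are at least 1.
Σ-complementary : ∀ (u τ : ℕ → ℚ) φ k l n →
  Σ[ i ← upTo (suc n) ] (u (suc i) * ((𝟙 (k ≟ suc i) * φ) * (𝟙 (l ≟ n ℕ.∸ i) * τ (suc i)))) ≡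
  𝟙 (k ℕ.+ l ≟ suc n) * (positive k * (u k * (φ * τ k)))
Σ-complementary u τ φ zero l n = begin
  Σ[ i ← upTo (suc n) ] (u (suc i) * ((0ℚ * φ) * (𝟙 (l ≟ n ℕ.∸ i) * τ (suc i))))
    ≡⟨ Σ-cong (upTo (suc n)) (λ i → vanish (u (suc i)) φ (𝟙 (l ≟ n ℕ.∸ i) * τ (suc i))) ⟩
  Σ[ i ← upTo (suc n) ] 0ℚ
    ≡⟨ Σ-0 (upTo (suc n)) ⟩
  0ℚ
    ≡⟨ sym (vanish′ (𝟙 (l ≟ suc n)) (u 0 * (φ * τ 0))) ⟩
  𝟙 (l ≟ suc n) * (0ℚ * (u 0 * (φ * τ 0))) ∎
  where
  vanish : ∀ a b c → a * ((0ℚ * b) * c) ≡ 0ℚ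
  vanish = solve-∀ ℚ-ring
  vanish′ : ∀ a b → a * (0ℚ * b) ≡ 0ℚ
  vanish′ = solve-∀ ℚ-ring
Σ-complementary u τ φ (suc k) l n = begin
  Σ[ i ← upTo (suc n) ] (u (suc i) * ((𝟙 (k ≟ i) * φ) * (𝟙 (l ≟ n ℕ.∸ i) * τ (suc i))))
    ≡⟨ Σ-cong (upTo (suc n)) (λ i →
         rearrange (u (suc i)) (𝟙 (k ≟ i)) φ (𝟙 (l ≟ n ℕ.∸ i)) (τ (suc i))) ⟩
  Σ[ i ← upTo (suc n) ] (𝟙 (k ≟ i) * (𝟙 (l ≟ n ℕ.∸ i) * (1ℚ * (u (suc i) * (φ * τ (suc i))))))
    ≡⟨ Σ-upTo-𝟙 (λ i → 𝟙 (l ≟ n ℕ.∸ i) * (1ℚ * (u (suc i) * (φ * τ (suc i))))) k (suc n) ⟩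
  𝟙 (k ℕ.<? suc n) * (𝟙 (l ≟ n ℕ.∸ k) * (1ℚ * (u (suc k) * (φ * τ (suc k)))))
    ≡⟨ sym (*-assoc (𝟙 (k ℕ.<? suc n)) (𝟙 (l ≟ n ℕ.∸ k)) _) ⟩
  (𝟙 (k ℕ.<? suc n) * 𝟙 (l ≟ n ℕ.∸ k)) * (1ℚ * (u (suc k) * (φ * τ (suc k))))
    ≡⟨ cong (_* (1ℚ * (u (suc k) * (φ * τ (suc k))))) (𝟙-complement k n l) ⟩
  𝟙 (k ℕ.+ l ≟ n) * (1ℚ * (u (suc k) * (φ * τ (suc k)))) ∎
  where
  rearrange : ∀ a b c d e → a * ((b * c) * (d * e)) ≡ b * (d * (1ℚ * (a * (c * e))))
  rearrange = solve-∀ ℚ-ring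

parts : (ℕ → Series) → Composition → Series
parts F α = productₛ (map (F ∘ value) α)

-- Common form of the two kinds of weights, so that one induction serves both: a constant -1 gives
-- the sign, reciprocals of the partial sums give 1/Z.
weight : (ℕ → ℚ) → ℕ → Composition → ℚ
weight v s []      = 1ℚ
weight v s (k ∷ α) = v (s ℕ.+ value k) * weight v (s ℕ.+ value k) α

Generates : (ℕ → Series) → (ℕ → List Composition) → (Composition → ℚ) → (Monomial → ℚ) → Set
Generates F A w f = ∀ n m →
  Σ[ α ← A n ] (w α * coeff (parts F α) m) ≡ 𝟙 (degree m ≟ n) * f m

-- Restricted to positive degrees, since parts are positive and `P 0` is not meaningful.
Represents : (ℕ → Series) → (Monomial → ℚ) → Set
Represents F f = ∀ d m → coeff (F (suc d)) m ≡ 𝟙 (degree m ≟ suc d) * f m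

-- The functions t s, weighting the compositions that are preceded by parts
-- of sum s, are characterized by splitting off the first part.

module CompositionSums
  (F : ℕ → Series) (f : Monomial → ℚ) (v : ℕ → ℚ) (t : ℕ → Monomial → ℚ)
  (F-f : Represents F f)
  (t-base : ∀ s m → degree m ≡ 0 → t s m ≡ 1ℚ)
  (t-step : ∀ s m n → degree m ≡ suc n → t s m ≡
    Σ[ a , b ← splittings m ] (positive (degree a) *
      (v (s ℕ.+ degree a) * (f a * t (s ℕ.+ degree a) b))))
  where

  ofLength : ℕ → ℕ → ℕ → Monomial → ℚ
  ofLength l s n m = Σ[ α ← compositionsOfLength l n ] (weight v s α * coeff (parts F α) m)

  ofLength-suc : ∀ l s n m → ofLength (suc l) s n m ≡
    Σ[ i ← upTo n ] (v (s ℕ.+ suc i) *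
      (coeff (F (suc i)) ⋆ ofLength l (s ℕ.+ suc i) (n ℕ.∸ suc i)) m)
  ofLength-suc l s n m = trans
    (Σ-concatMap term (λ i → map (pos (suc i) ∷_) (compositionsOfLength l (n ℕ.∸ suc i))) (upTo n))
    (Σ-cong (upTo n) (λ i → trans
      (Σ-map term (pos (suc i) ∷_) (compositionsOfLength l (n ℕ.∸ suc i))) (first-part i)))
    where
    term : Composition → ℚ
    term α = weight v s α * coeff (parts F α) m
    rearrange : ∀ a b c → a * (b * c) ≡ b * (a * c)
    rearrange = solve-∀ ℚ-ring
    first-part : ∀ i → let cs = compositionsOfLength l (n ℕ.∸ suc i) ; s′ = s ℕ.+ suc i in
      Σ[ α ← cs ] term (pos (suc i) ∷ α) ≡ v s′ * (coeff (F (suc i)) ⋆ ofLength l s′ (n ℕ.∸ suc i)) m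
    first-part i = begin
      Σ[ α ← cs ] ((v s′ * weight v s′ α) * (F₁ ⋆ coeff (parts F α)) m)
        ≡⟨ trans (Σ-cong cs (λ α → *-assoc (v s′) (weight v s′ α) ((F₁ ⋆ coeff (parts F α)) m)))
                 (Σ-*ˡ (v s′) (λ α → weight v s′ α * (F₁ ⋆ coeff (parts F α)) m) cs) ⟩
      v s′ * (Σ[ α ← cs ] (weight v s′ α * (F₁ ⋆ coeff (parts F α)) m))
        ≡⟨ cong (v s′ *_) (Σ-cong cs (λ α → trans
             (sym (Σ-*ˡ (weight v s′ α) (λ (a , b) → F₁ a * coeff (parts F α) b) (splittings m)))
             (Σ-cong (splittings m) (λ (a , b) →
               rearrange (weight v s′ α) (F₁ a) (coeff (parts F α) b))))) ⟩
      v s′ * (Σ[ α ← cs ] Σ[ a , b ← splittings m ] (F₁ a * (weight v s′ α * coeff (parts F α) b)))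
        ≡⟨ cong (v s′ *_) (trans
             (Σ-swap (λ α (a , b) → F₁ a * (weight v s′ α * coeff (parts F α) b)) cs (splittings m))
             (Σ-cong (splittings m) (λ (a , b) →
               Σ-*ˡ (F₁ a) (λ α → weight v s′ α * coeff (parts F α) b) cs))) ⟩
      v s′ * (F₁ ⋆ ofLength l s′ (n ℕ.∸ suc i)) m ∎
      where
      cs : List Composition
      cs = compositionsOfLength l (n ℕ.∸ suc i)
      s′ : ℕ
      s′ = s ℕ.+ suc i
      F₁ : Monomial → ℚ
      F₁ = coeff (F (suc i))

  -- A composition of `n` has at most `n` parts, so every `L` from `n` on counts them all. With `L`
  -- free, the induction on it uses the same bound for all sizes `n ℕ.∸ i` left over by the first
  -- part.
  Σ-ofLength : ∀ {L n} → n ≤ L → ∀ s m →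
               Σ[ l ← upTo (suc L) ] ofLength l s n m ≡ 𝟙 (degree m ≟ n) * t s m
  Σ-ofLength {L} {zero} _ s m = begin
    Σ[ l ← upTo (suc L) ] ofLength l s 0 m
      ≡⟨ Σ-upTo (λ l → ofLength l s 0 m) L ⟩
    (1ℚ * coeff 1ₛ m + 0ℚ) + Σ[ l ← upTo L ] 0ℚ
      ≡⟨ trans (cong (1ℚ * coeff 1ₛ m + 0ℚ +_) (Σ-0 (upTo L))) (unit (coeff 1ₛ m)) ⟩
    coeff 1ₛ m
      ≡⟨ trans (coeff-1ₛ m) (δ≡𝟙degree m) ⟩
    𝟙 (degree m ≟ 0)
      ≡⟨ base (degree m ≟ 0) ⟩
    𝟙 (degree m ≟ 0) * t s m ∎
    where
    unit : ∀ q → (1ℚ * q + 0ℚ) + 0ℚ ≡ q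
    unit = solve-∀ ℚ-ring
    base : (deg? : Dec (degree m ≡ 0)) → 𝟙 deg? ≡ 𝟙 deg? * t s m
    base (yes deg) = cong (1ℚ *_) (sym (t-base s m deg))
    base (no _)    = sym (*-zeroˡ (t s m))
  Σ-ofLength {suc L} {suc n} (s≤s n≤L) s m = begin
    Σ[ l ← upTo (suc (suc L)) ] ofLength l s (suc n) m
      ≡⟨ trans (Σ-upTo (λ l → ofLength l s (suc n) m) (suc L))
               (+-identityˡ (Σ[ l ← upTo (suc L) ] ofLength (suc l) s (suc n) m)) ⟩
    Σ[ l ← upTo (suc L) ] ofLength (suc l) s (suc n) m
      ≡⟨ trans (Σ-cong (upTo (suc L)) (λ l → ofLength-suc l s (suc n) m))
               (Σ-swap (λ l i → v (s ℕ.+ suc i) * (F₁ i ⋆ ofLength l (s ℕ.+ suc i) (n ℕ.∸ i)) m)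
                 (upTo (suc L)) (upTo (suc n))) ⟩
    Σ[ i ← upTo (suc n) ] Σ[ l ← upTo (suc L) ]
      (v (s ℕ.+ suc i) * (F₁ i ⋆ ofLength l (s ℕ.+ suc i) (n ℕ.∸ i)) m)
      ≡⟨ Σ-cong (upTo (suc n)) all-lengths ⟩
    Σ[ i ← upTo (suc n) ] Σ[ a , b ← splittings m ] summand i a b
      ≡⟨ Σ-swap (λ i (a , b) → summand i a b) (upTo (suc n)) (splittings m) ⟩
    Σ[ a , b ← splittings m ] Σ[ i ← upTo (suc n) ] summand i a b
      -- The condition on the sum of the degrees of `a` and `b` becomes one on `degree m` and can
      -- leave the sum.
      ≡⟨ graded _ _ m (λ a b deg → trans
           (Σ-complementary (λ k → v (s ℕ.+ k)) (λ k → t (s ℕ.+ k) b) (f a) (degree a) (degree b) n)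
           (cong (λ k → 𝟙 (k ≟ suc n) * step a b) deg)) ⟩
    Σ[ a , b ← splittings m ] (𝟙 (degree m ≟ suc n) * step a b)
      ≡⟨ Σ-*ˡ (𝟙 (degree m ≟ suc n)) (uncurry step) (splittings m) ⟩
    𝟙 (degree m ≟ suc n) * Sum₂ (splittings m) step
      ≡⟨ by-degree (degree m ≟ suc n) ⟩
    𝟙 (degree m ≟ suc n) * t s m ∎
    where
    F₁ : ℕ → Monomial → ℚ
    F₁ i = coeff (F (suc i))
    summand : ℕ → Monomial → Monomial → ℚ
    summand i a b = v (s ℕ.+ suc i) *
      ((𝟙 (degree a ≟ suc i) * f a) * (𝟙 (degree b ≟ n ℕ.∸ i) * t (s ℕ.+ suc i) b))
    step : Monomial → Monomial → ℚ
    step a b = positive (degree a) * (v (s ℕ.+ degree a) * (f a * t (s ℕ.+ degree a) b))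
    all-lengths : ∀ i → Σ[ l ← upTo (suc L) ]
      (v (s ℕ.+ suc i) * (F₁ i ⋆ ofLength l (s ℕ.+ suc i) (n ℕ.∸ i)) m) ≡
      Σ[ a , b ← splittings m ] summand i a b
    all-lengths i = begin
      Σ[ l ← upTo (suc L) ] (v s′ * (F₁ i ⋆ ofLength l s′ (n ℕ.∸ i)) m)
        ≡⟨ Σ-*ˡ (v s′) (λ l → (F₁ i ⋆ ofLength l s′ (n ℕ.∸ i)) m) (upTo (suc L)) ⟩
      v s′ * (Σ[ l ← upTo (suc L) ] (F₁ i ⋆ ofLength l s′ (n ℕ.∸ i)) m)
        ≡⟨ cong (v s′ *_) (trans
             (Σ-swap (λ l (a , b) → F₁ i a * ofLength l s′ (n ℕ.∸ i) b) (upTo (suc L)) (splittings m))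
             (Σ-cong (splittings m) (λ (a , b) →
               trans (Σ-*ˡ (F₁ i a) (λ l → ofLength l s′ (n ℕ.∸ i) b) (upTo (suc L)))
                     (cong₂ _*_ (F-f i a) (Σ-ofLength (ℕ.≤-trans (ℕ.m∸n≤m n i) n≤L) s′ b))))) ⟩
      v s′ * (Σ[ a , b ← splittings m ]
        ((𝟙 (degree a ≟ suc i) * f a) * (𝟙 (degree b ≟ n ℕ.∸ i) * t s′ b)))
        ≡⟨ sym (Σ-*ˡ (v s′) (λ (a , b) →
             (𝟙 (degree a ≟ suc i) * f a) * (𝟙 (degree b ≟ n ℕ.∸ i) * t s′ b)) (splittings m)) ⟩
      Σ[ a , b ← splittings m ] summand i a b ∎
      where
      s′ : ℕ
      s′ = s ℕ.+ suc i
    by-degree : (deg? : Dec (degree m ≡ suc n)) →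
                𝟙 deg? * Sum₂ (splittings m) step ≡ 𝟙 deg? * t s m
    by-degree (yes deg) = cong (1ℚ *_) (sym (t-step s m n deg))
    by-degree (no _)    = trans (*-zeroˡ (Sum₂ (splittings m) step)) (sym (*-zeroˡ (t s m)))

  compositions-generate : Generates F compositions (weight v 0) (t 0)
  compositions-generate n m = trans
    (Σ-concatMap (λ α → weight v 0 α * coeff (parts F α) m)
      (λ l → compositionsOfLength l n) (upTo (suc n)))
    (Σ-ofLength ℕ.≤-refl 0 m)

-- Inverses as signed sums over compositions

positive≡1-δ₀ : ∀ n → positive n ≡ 1ℚ + - δ₀ n
positive≡1-δ₀ zero    = refl
positive≡1-δ₀ (suc n) = refl

δ-multiplicative : ∀ φ → φ 0 ≡ 1ℚ → ∀ m → δ m * multiplicative φ m ≡ δ m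
δ-multiplicative φ φ0 m = trans (multiplicative-* δ₀ φ m) (multiplicative-cong
  (λ { zero → trans (*-identityˡ (φ 0)) φ0 ; (suc n) → *-zeroˡ (φ (suc n)) }) m)

positive-degree : ∀ m → positive (degree m) ≡ 1ℚ + - δ m
positive-degree m = trans (positive≡1-δ₀ (degree m)) (cong (λ q → 1ℚ + - q) (sym (δ≡𝟙degree m)))

δ≡1 : ∀ m → degree m ≡ 0 → δ m ≡ 1ℚ
δ≡1 m deg = trans (δ≡𝟙degree m) (𝟙-yes (degree m ≟ 0) deg)

δ≡0 : ∀ m n → degree m ≡ suc n → δ m ≡ 0ℚ
δ≡0 m n deg = trans (δ≡𝟙degree m) (cong δ₀ deg)

module Inverse (φ ψ : ℕ → ℚ) (φ0 : φ 0 ≡ 1ℚ) (ψ0 : ψ 0 ≡ 1ℚ)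
               (inverse : ∀ m → (multiplicative φ ⋆ multiplicative ψ) m ≡ δ m) where

  private
    a b : Monomial → ℚ
    a = multiplicative φ
    b = multiplicative ψ

  degree-0 : ∀ m → degree m ≡ 0 → b m ≡ 1ℚ
  degree-0 m deg = begin
    b m         ≡⟨ sym (*-identityˡ (b m)) ⟩
    1ℚ * b m    ≡⟨ cong (_* b m) (sym (δ≡1 m deg)) ⟩
    δ m * b m   ≡⟨ δ-multiplicative ψ ψ0 m ⟩
    δ m         ≡⟨ δ≡1 m deg ⟩
    1ℚ          ∎

  -- From AB = 1 follows - (A - 1) B = B - 1, where A - 1 is the part of A of positive degree; in
  -- positive degree the constant 1 disappears.
  first-part : ∀ m n → degree m ≡ suc n →
    b m ≡ Σ[ x , y ← splittings m ] (positive (degree x) * (- 1ℚ * (a x * b y)))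
  first-part m n deg = sym (begin
    Σ[ x , y ← splittings m ] (positive (degree x) * (- 1ℚ * (a x * b y)))
      ≡⟨ Σ-cong (splittings m) (λ (x , y) → begin
           positive (degree x) * (- 1ℚ * (a x * b y))
             ≡⟨ cong (_* (- 1ℚ * (a x * b y))) (positive-degree x) ⟩
           (1ℚ + - δ x) * (- 1ℚ * (a x * b y))
             ≡⟨ expand (δ x) (a x) (b y) ⟩
           - 1ℚ * (a x * b y) + (δ x * a x) * b y
             ≡⟨ cong (λ q → - 1ℚ * (a x * b y) + q * b y) (δ-multiplicative φ φ0 x) ⟩
           - 1ℚ * (a x * b y) + δ x * b y ∎) ⟩
    Σ[ x , y ← splittings m ] (- 1ℚ * (a x * b y) + δ x * b y)
      ≡⟨ Σ-+ (λ (x , y) → - 1ℚ * (a x * b y)) (λ (x , y) → δ x * b y) (splittings m) ⟩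
    Σ[ x , y ← splittings m ] (- 1ℚ * (a x * b y)) + (δ ⋆ b) m
      ≡⟨ cong₂ _+_ (trans (Σ-*ˡ (- 1ℚ) (λ (x , y) → a x * b y) (splittings m))
           (cong (- 1ℚ *_) (trans (inverse m) (δ≡0 m n deg)))) (⋆-identityˡ b m) ⟩
    - 1ℚ * 0ℚ + b m
      ≡⟨ +-identityˡ (b m) ⟩
    b m ∎)
    where
    expand : ∀ d p q → (1ℚ + - d) * (- 1ℚ * (p * q)) ≡ - 1ℚ * (p * q) + (d * p) * q
    expand = solve-∀ ℚ-ring

  signed-compositions-generate : ∀ F → Represents F a →
    Generates F compositions (weight (λ _ → - 1ℚ) 0) b
  signed-compositions-generate F F-a =
    -- Signs ignore partial sums, so one function serves for all `s`.
    CompositionSums.compositions-generate F a (λ _ → - 1ℚ) (λ _ → b) F-a (λ _ → degree-0)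
      (λ _ → first-part)

-- Integrating logarithmic derivatives: the weights 1/Z

p-degree-0 : ∀ m → degree m ≡ 0 → p m ≡ 0ℚ
p-degree-0 m deg with purePower⊎p≡0 m
... | inj₂ p≡0              = p≡0
... | inj₁ (i , j , k , eq) =
  contradiction (trans (sym deg) (degree-power {m} i j (suc k) eq)) (λ ())

-- κ s k = s/(s + k), read as 1 for s = k = 0.

κ : ℕ → ℕ → ℚ
κ s zero    = 1ℚ
κ s (suc k) = fromℕ s * recip (s ℕ.+ suc k)

κ-0 : ∀ k → κ 0 k ≡ δ₀ k
κ-0 zero    = refl
κ-0 (suc k) = *-zeroˡ (recip (suc k))

-- The numerator of `κ` cancels, leaving a function of the total alone; this lets two pieces be
-- merged into one. The first argument must be positive, as `κ 0 k` vanishes for positive `k`.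
recip-κ : ∀ s k → recip (suc s) * κ (suc s) k ≡ recip (suc s ℕ.+ k)
recip-κ s zero    = trans (*-identityʳ (recip (suc s))) (cong recip (sym (ℕ.+-identityʳ (suc s))))
recip-κ s (suc k) = begin
  recip (suc s) * (fromℕ (suc s) * recip (suc s ℕ.+ suc k))
    ≡⟨ rearrange (recip (suc s)) (fromℕ (suc s)) (recip (suc s ℕ.+ suc k)) ⟩
  (fromℕ (suc s) * recip (suc s)) * recip (suc s ℕ.+ suc k)
    ≡⟨ cong (_* recip (suc s ℕ.+ suc k)) (fromℕ*recip s) ⟩
  1ℚ * recip (suc s ℕ.+ suc k)
    ≡⟨ *-identityˡ (recip (suc s ℕ.+ suc k)) ⟩
  recip (suc s ℕ.+ suc k) ∎
  where
  rearrange : ∀ x y z → x * (y * z) ≡ (y * x) * z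
  rearrange = solve-∀ ℚ-ring

-- Reading 0/0 in `κ` as 1 makes this hold at `s = k = 0` too.
1-κ : ∀ s k → recip (s ℕ.+ k) * fromℕ k ≡ 1ℚ + - κ s k
1-κ s zero    = *-zeroʳ (recip (s ℕ.+ 0))
1-κ s (suc k) = begin
  r * fromℕ (suc k)
    ≡⟨ split (fromℕ s) (fromℕ (suc k)) r ⟩
  (fromℕ s + fromℕ (suc k)) * r + - (fromℕ s * r)
    ≡⟨ cong (λ q → q * r + - (fromℕ s * r)) (sym (fromℕ-+ s (suc k))) ⟩
  fromℕ (s ℕ.+ suc k) * r + - (fromℕ s * r)
    ≡⟨ cong (_+ - (fromℕ s * r)) (subst (λ n → fromℕ n * recip n ≡ 1ℚ) (sym (ℕ.+-suc s k)) (fromℕ*recip (s ℕ.+ k))) ⟩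
  1ℚ + - (fromℕ s * r) ∎
  where
  r : ℚ
  r = recip (s ℕ.+ suc k)
  split : ∀ x y z → z * y ≡ (x + y) * z + - (x * z)
  split = solve-∀ ℚ-ring

-- With A, B, Q the series with coefficients a, b, p, the hypotheses say that
-- AB = 1 and that Q is -c⁻¹ times the logarithmic derivative of A; the
-- function t s below solves the recursion for the sums of Q_α c^ℓ(α)/Z_α.

module LogarithmicDerivative
  (φ ψ : ℕ → ℚ) (φ0 : φ 0 ≡ 1ℚ)
  (inverse : ∀ m → (multiplicative φ ⋆ multiplicative ψ) m ≡ δ m)
  (c c′ : ℚ) (cc′ : c * c′ ≡ - 1ℚ)
  (p⋆a : ∀ m → (p ⋆ multiplicative φ) m ≡ (c′ * fromℕ (degree m)) * multiplicative φ m)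
  where

  private
    a b : Monomial → ℚ
    a = multiplicative φ
    b = multiplicative ψ
    v : ℕ → ℚ
    v k = c * recip k

  t : ℕ → Monomial → ℚ
  t s = (λ m → κ s (degree m) * a m) ⋆ b

  t-0 : ∀ m → t 0 m ≡ b m
  t-0 m = trans
    (Σ-cong (splittings m) (λ (x , y) → cong (_* b y) (trans
      (cong (_* a x) (trans (κ-0 (degree x)) (sym (δ≡𝟙degree x))))
      (δ-multiplicative φ φ0 x))))
    (⋆-identityˡ b m)

  t-base : ∀ s m → degree m ≡ 0 → t s m ≡ 1ℚ
  t-base s m deg = begin
    t s m
      ≡⟨ graded _ _ m (λ x y eq → cong (_* b y) (trans
           (cong (λ k → κ s k * a x) (ℕ.m+n≡0⇒m≡0 (degree x) (trans eq deg)))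
           (*-identityˡ (a x)))) ⟩
    (a ⋆ b) m
      ≡⟨ trans (inverse m) (δ≡1 m deg) ⟩
    1ℚ ∎

  -- Expanding `t` on the second piece gives a sum over triples. Regrouped by coassociativity, its
  -- first two pieces combine into `p ⋆ a`, which is `c′` times the degree times `a`. By `cc′` and
  -- `1-κ` the outcome is `t s` minus AB, and AB vanishes in positive degree.
  t-step : ∀ s m n → degree m ≡ suc n → t s m ≡
    Σ[ x , y ← splittings m ] (positive (degree x) *
      (v (s ℕ.+ degree x) * (p x * t (s ℕ.+ degree x) y)))
  t-step s m n deg = sym (begin
    Σ[ x , w ← splittings m ] (positive (degree x) *
      (v (s ℕ.+ degree x) * (p x * t (s ℕ.+ degree x) w)))
      ≡⟨ Σ-cong (splittings m) (λ (x , w) → trans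
           (factor (positive (degree x)) (v (s ℕ.+ degree x)) (p x) (t (s ℕ.+ degree x) w))
           (sym (Σ-*ˡ (coefficient x)
             (λ (y , z) → (κ (s ℕ.+ degree x) (degree y) * a y) * b z) (splittings w)))) ⟩
    Σ[ x , w ← splittings m ] Σ[ y , z ← splittings w ]
      (coefficient x * ((κ (s ℕ.+ degree x) (degree y) * a y) * b z))
      ≡⟨ sym (coassociative
           (λ x y z → coefficient x * ((κ (s ℕ.+ degree x) (degree y) * a y) * b z)) m) ⟩
    Σ[ w , z ← splittings m ] Σ[ x , y ← splittings w ]
      (coefficient x * ((κ (s ℕ.+ degree x) (degree y) * a y) * b z))
      ≡⟨ Σ-cong (splittings m) (λ (w , z) → trans
           (graded _ _ w (λ x y eq → merge x y z (degree w) eq))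
           (Σ-*ˡ (v (s ℕ.+ degree w) * b z) (λ (x , y) → p x * a y) (splittings w))) ⟩
    Σ[ w , z ← splittings m ] ((v (s ℕ.+ degree w) * b z) * (p ⋆ a) w)
      ≡⟨ Σ-cong (splittings m) (λ (w , z) → differentiate w z) ⟩
    Σ[ w , z ← splittings m ] ((κ s (degree w) * a w) * b z + - 1ℚ * (a w * b z))
      ≡⟨ Σ-+ (λ (w , z) → (κ s (degree w) * a w) * b z) (λ (w , z) → - 1ℚ * (a w * b z)) (splittings m) ⟩
    t s m + Σ[ w , z ← splittings m ] (- 1ℚ * (a w * b z))
      ≡⟨ cong (t s m +_) (trans (Σ-*ˡ (- 1ℚ) (λ (w , z) → a w * b z) (splittings m))
           (cong (- 1ℚ *_) (trans (inverse m) (δ≡0 m n deg)))) ⟩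
    t s m + - 1ℚ * 0ℚ
      ≡⟨ +-identityʳ (t s m) ⟩
    t s m ∎)
    where
    coefficient : Monomial → ℚ
    coefficient x = positive (degree x) * (v (s ℕ.+ degree x) * p x)
    factor : ∀ i j k l → i * (j * (k * l)) ≡ (i * (j * k)) * l
    factor = solve-∀ ℚ-ring

    merge : ∀ x y z k → degree x ℕ.+ degree y ≡ k →
      coefficient x * ((κ (s ℕ.+ degree x) (degree y) * a y) * b z) ≡ (v (s ℕ.+ k) * b z) * (p x * a y)
    merge x y z _ refl = go (degree x) refl
      where
      vanish : ∀ i j k l → (0ℚ * i) * j ≡ (k * l) * (0ℚ * a y)
      vanish i j k l = vanish′ i j k l (a y)
        where
        vanish′ : ∀ i j k l q → (0ℚ * i) * j ≡ (k * l) * (0ℚ * q)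
        vanish′ = solve-∀ ℚ-ring
      rearrange : ∀ c r κ p a b → (1ℚ * ((c * r) * p)) * ((κ * a) * b) ≡ ((c * (r * κ)) * b) * (p * a)
      rearrange = solve-∀ ℚ-ring
      go : ∀ k → degree x ≡ k →
        (positive k * (v (s ℕ.+ k) * p x)) * ((κ (s ℕ.+ k) (degree y) * a y) * b z) ≡
        (v (s ℕ.+ (k ℕ.+ degree y)) * b z) * (p x * a y)
      -- In degree 0 the left side vanishes through `positive`, the right side because `p` has no
      -- constant term.
      go zero    dx = trans
        (vanish (v (s ℕ.+ 0) * p x) ((κ (s ℕ.+ 0) (degree y) * a y) * b z) (v (s ℕ.+ degree y)) (b z))
        (cong (λ q → (v (s ℕ.+ degree y) * b z) * (q * a y)) (sym (p-degree-0 x dx)))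
      go (suc k) dx = trans
        (rearrange c (recip (s ℕ.+ suc k)) (κ (s ℕ.+ suc k) (degree y)) (p x) (a y) (b z))
        (cong (λ q → ((c * q) * b z) * (p x * a y)) (trans
          (cong (λ j → recip j * κ j (degree y)) (ℕ.+-suc s k))
          (trans (recip-κ (s ℕ.+ k) (degree y)) (cong recip
            (trans (cong (ℕ._+ degree y) (sym (ℕ.+-suc s k))) (ℕ.+-assoc s (suc k) (degree y)))))))

    differentiate : ∀ w z → (v (s ℕ.+ degree w) * b z) * (p ⋆ a) w ≡
                    (κ s (degree w) * a w) * b z + - 1ℚ * (a w * b z)
    differentiate w z = begin
      (v (s ℕ.+ degree w) * b z) * (p ⋆ a) w
        ≡⟨ cong ((v (s ℕ.+ degree w) * b z) *_) (p⋆a w) ⟩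
      ((c * r) * b z) * ((c′ * fromℕ (degree w)) * a w)
        ≡⟨ rearrange c r (b z) c′ (fromℕ (degree w)) (a w) ⟩
      (c * c′) * (r * fromℕ (degree w)) * (a w * b z)
        ≡⟨ cong₂ (λ q q′ → q * q′ * (a w * b z)) cc′ (1-κ s (degree w)) ⟩
      - 1ℚ * (1ℚ + - κ s (degree w)) * (a w * b z)
        ≡⟨ expand (κ s (degree w)) (a w) (b z) ⟩
      (κ s (degree w) * a w) * b z + - 1ℚ * (a w * b z) ∎
      where
      r : ℚ
      r = recip (s ℕ.+ degree w)
      rearrange : ∀ c r b c′ n a → ((c * r) * b) * ((c′ * n) * a) ≡ (c * c′) * (r * n) * (a * b)
      rearrange = solve-∀ ℚ-ring
      expand : ∀ k a b → - 1ℚ * (1ℚ + - k) * (a * b) ≡ (k * a) * b + - 1ℚ * (a * b)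
      expand = solve-∀ ℚ-ring

  compositions-generate : Generates P compositions (weight v 0) b
  compositions-generate n m = trans
    (CompositionSums.compositions-generate P p v t coeff-P t-base t-step n m)
    (cong (𝟙 (degree m ≟ n) *_) (t-0 m))

-- Evaluation of the weights, and compositions with at most one part

weight-sign : ∀ s α → weight (λ _ → - 1ℚ) s α ≡ -1^ ℓ α
weight-sign s []      = refl
weight-sign s (k ∷ α) = trans (cong (- 1ℚ *_) (weight-sign (s ℕ.+ value k) α)) (negate (-1^ ℓ α))
  where
  negate : ∀ q → - 1ℚ * q ≡ - q
  negate = solve-∀ ℚ-ring

weight-recip : ∀ s α → weight (λ k → 1ℚ * recip k) s α ≡ recip (Z-from s α)
weight-recip s []      = refl
weight-recip s (k ∷ α) = trans
  (cong₂ _*_ (*-identityˡ (recip (s ℕ.+ value k))) (weight-recip (s ℕ.+ value k) α))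
  (sym (recip-* (s ℕ.+ value k) (Z-from (s ℕ.+ value k) α)))

weight-signed-recip : ∀ s α → weight (λ k → - 1ℚ * recip k) s α ≡ -1^ ℓ α * recip (Z-from s α)
weight-signed-recip s []      = refl
weight-signed-recip s (k ∷ α) = begin
  (- 1ℚ * recip s′) * weight (λ k → - 1ℚ * recip k) s′ α
    ≡⟨ cong ((- 1ℚ * recip s′) *_) (weight-signed-recip s′ α) ⟩
  (- 1ℚ * recip s′) * (-1^ ℓ α * recip (Z-from s′ α))
    ≡⟨ rearrange (recip s′) (-1^ ℓ α) (recip (Z-from s′ α)) ⟩
  - (-1^ ℓ α) * (recip s′ * recip (Z-from s′ α))
    ≡⟨ cong (- (-1^ ℓ α) *_) (sym (recip-* s′ (Z-from s′ α))) ⟩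
  - (-1^ ℓ α) * recip (s′ ℕ.* Z-from s′ α) ∎
  where
  s′ : ℕ
  s′ = s ℕ.+ value k
  rearrange : ∀ x y z → (- 1ℚ * x) * (y * z) ≡ - y * (x * z)
  rearrange = solve-∀ ℚ-ring

1/Z≡recip : ∀ α → 1/Z α ≡ recip (Z α)
1/Z≡recip α = go (Z α) {{Z-from-nonZero 0 α}}
  where
  go : ∀ n .{{_ : ℕ.NonZero n}} → ℤ.+ 1 ℚ./ n ≡ recip n
  go (suc n) = refl

-- Size 0 is treated apart because `F 0` does not occur in it: the empty composition gives `1ₛ`, the
-- constant term since `φ 0` is 1.
row-generates : ∀ F φ → φ 0 ≡ 1ℚ → Represents F (multiplicative φ) →
                Generates F ([_] ∘ row) (λ _ → 1ℚ) (multiplicative φ)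
row-generates F φ φ0 F-φ n m = trans (unit (coeff (parts F (row n)) m)) (go n)
  where
  unit : ∀ q → 1ℚ * q + 0ℚ ≡ q
  unit = solve-∀ ℚ-ring
  go : ∀ n → coeff (parts F (row n)) m ≡ 𝟙 (degree m ≟ n) * multiplicative φ m
  go zero    = begin
    coeff 1ₛ m                                ≡⟨ coeff-1ₛ m ⟩
    δ m                                       ≡⟨ sym (δ-multiplicative φ φ0 m) ⟩
    δ m * multiplicative φ m                  ≡⟨ cong (_* multiplicative φ m) (δ≡𝟙degree m) ⟩
    𝟙 (degree m ≟ 0) * multiplicative φ m     ∎
  go (suc n) = begin
    (coeff (F (suc n)) ⋆ coeff 1ₛ) m          ≡⟨ ⋆-cong {f = coeff (F (suc n))} (λ _ → refl) coeff-1ₛ m ⟩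
    (coeff (F (suc n)) ⋆ δ) m                 ≡⟨ ⋆-identityʳ (coeff (F (suc n))) m ⟩
    coeff (F (suc n)) m                       ≡⟨ F-φ n m ⟩
    𝟙 (degree m ≟ suc n) * multiplicative φ m ∎

-- Sums over polycompositions

δ-dilated : ∀ m → dilated δ m ≡ δ m
δ-dilated m = trans
  (cong (evens m *_) (trans (prod-map (prod δ₀) (map (_/ 2)) m) (prod-cong (prod-map δ₀ (_/ 2)) m)))
  (trans (multiplicative-* even (λ n → δ₀ (n / 2)) m) (multiplicative-cong
    (λ { zero → refl ; (suc zero) → refl
       ; (suc (suc n)) → trans (cong (λ k → even (suc (suc n)) * δ₀ k) (2+n/2 n))
                               (*-zeroʳ (even (suc (suc n)))) }) m))

-- The alternative suits the induction: a single vanishing factor makes the whole product vanish,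
-- and otherwise the doubled degrees add up.
evens⊎double : ∀ {A : Set} {pw : A → ℚ} {rt : A → A} (deg : ℕ → A → ℕ) →
  (∀ i x → pw x ≡ 0ℚ ⊎ deg i x ≡ 2 ℕ.* deg i (rt x)) →
  ∀ xs → prod pw xs ≡ 0ℚ ⊎ sumAt deg xs ≡ 2 ℕ.* sumAt deg (map rt xs)
evens⊎double                deg eq []       = inj₂ refl
evens⊎double {pw = pw} {rt} deg eq (x ∷ xs) with eq 0 x | evens⊎double (deg ∘ suc) (eq ∘ suc) xs
... | inj₁ pw≡0 | _          = inj₁ (trans (cong (_* prod pw xs) pw≡0) (*-zeroˡ (prod pw xs)))
... | inj₂ _    | inj₁ pws≡0 = inj₁ (trans (cong (pw x *_) pws≡0) (*-zeroʳ (pw x)))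
... | inj₂ dx   | inj₂ dxs   = inj₂ (trans (cong₂ ℕ._+_ dx dxs)
  (sym (ℕ.*-distribˡ-+ 2 (deg 0 (rt x)) (sumAt (deg ∘ suc) (map rt xs)))))

evens≡0⊎degree-double : ∀ m → evens m ≡ 0ℚ ⊎ degree m ≡ 2 ℕ.* degree (root 2 m)
evens≡0⊎degree-double = evens⊎double (λ i → sumAt (λ j n → suc i ℕ.* n))
  (λ i → evens⊎double (λ j n → suc i ℕ.* n) (λ j → element i))
  where
  element : ∀ i n → even n ≡ 0ℚ ⊎ suc i ℕ.* n ≡ 2 ℕ.* (suc i ℕ.* (n / 2))
  element i n with 2 ∣? n
  ... | no ¬2∣n = inj₁ (𝟙-no (2 ∣? n) ¬2∣n)
  ... | yes 2∣n = inj₂ (trans (cong (suc i ℕ.*_) (sym (m*[n/m]≡n 2∣n))) (x∙yz≈y∙xz (suc i) 2 (n / 2)))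
    where open CommSemigroup ℕ.*-commutativeSemigroup using (x∙yz≈y∙xz)

coeff-dilate-1 : ∀ F m → coeff (dilate 1 F) m ≡ coeff F m
coeff-dilate-1 F m = begin
  coeff (dilate 1 F) m
    ≡⟨ bit-* _ (coeff F (root 1 m)) ⟩
  𝟙 (isPower? 1 m) * coeff F (root 1 m)
    ≡⟨ cong₂ _*_ (𝟙-yes (isPower? 1 m) (λ i j → 1∣ exponent m i j)) (cong (coeff F) root-1) ⟩
  1ℚ * coeff F m
    ≡⟨ *-identityˡ (coeff F m) ⟩
  coeff F m ∎
  where
  root-1 : root 1 m ≡ m
  root-1 = trans (map-cong (λ r → trans (map-cong n/1≡n r) (map-id r)) m) (map-id m)

module _ (F : ℕ → Series) where

  private
    blockSeries : ℕ⁺ × ℕ⁺ → Series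
    blockSeries (d , r) = dilate (value r) (F (value d))

  coeff-undilated-blocks : ∀ α bs m →
    coeff (productₛ (map blockSeries (map (_, pos 1) α ++ bs))) m ≡
    (coeff (parts F α) ⋆ coeff (productₛ (map blockSeries bs))) m
  coeff-undilated-blocks []      bs m = sym (trans
    (⋆-cong {g = rest} coeff-1ₛ (λ _ → refl) m) (⋆-identityˡ rest m))
    where
    rest : Monomial → ℚ
    rest = coeff (productₛ (map blockSeries bs))
  coeff-undilated-blocks (k ∷ α) bs m = trans
    (⋆-cong (coeff-dilate-1 (F (value k))) (coeff-undilated-blocks α bs) m)
    (sym (⋆-assoc (coeff (F (value k))) (coeff (parts F α)) (coeff (productₛ (map blockSeries bs))) m))

  coeff-dilated-blocks : ∀ β m →
    coeff (productₛ (map blockSeries (map (_, pos 2) β ++ []))) m ≡ dilated (coeff (parts F β)) m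
  coeff-dilated-blocks []      m = trans (coeff-1ₛ m) (trans (sym (δ-dilated m))
    (cong (evens m *_) (sym (coeff-1ₛ (root 2 m)))))
  coeff-dilated-blocks (k ∷ β) m = trans
    (⋆-cong (coeff-dilate-2 (F (value k))) (coeff-dilated-blocks β) m)
    (dilated-⋆ (coeff (F (value k))) (coeff (parts F β)) m)

  coeff-⟦⟧ : ∀ α β m → coeff (F ⟦ α ¹ β ² ⟧) m ≡ (coeff (parts F α) ⋆ dilated (coeff (parts F β))) m
  coeff-⟦⟧ α β m = trans (coeff-undilated-blocks α (map (_, pos 2) β ++ []) m)
    (⋆-cong {f = coeff (parts F α)} (λ _ → refl) (coeff-dilated-blocks β) m)

-- Homogeneity: from the size of a polycomposition to the degree of a monomial

Homogeneous : ℕ → (Monomial → ℚ) → Set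
Homogeneous n f = ∀ m → degree m ≢ n → f m ≡ 0ℚ

⋆-homogeneous : ∀ {f g n k} → Homogeneous n f → Homogeneous k g → Homogeneous (n ℕ.+ k) (f ⋆ g)
⋆-homogeneous {f} {g} {n} {k} hf hg m ≢n+k = trans
  (graded (λ a b → f a * g b) (λ _ _ → 0ℚ) m (λ a b deg → split a b deg (degree a ≟ n)))
  (Σ-0 (splittings m))
  where
  split : ∀ a b → degree a ℕ.+ degree b ≡ degree m → Dec (degree a ≡ n) → f a * g b ≡ 0ℚ
  split a b deg (no  ≢n) = trans (cong (_* g b) (hf a ≢n)) (*-zeroˡ (g b))
  split a b deg (yes ≡n) = trans
    (cong (f a *_) (hg b (λ ≡k → ≢n+k (trans (sym deg) (cong₂ ℕ._+_ ≡n ≡k))))) (*-zeroʳ (f a))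

dilated-homogeneous : ∀ {f n} → Homogeneous n f → Homogeneous (2 ℕ.* n) (dilated f)
dilated-homogeneous {f} hf m ≢2n with evens≡0⊎degree-double m
... | inj₁ ≡0  = trans (cong (_* f (root 2 m)) ≡0) (*-zeroˡ (f (root 2 m)))
... | inj₂ deg = trans (cong (evens m *_) (hf (root 2 m) (λ ≡n → ≢2n (trans deg (cong (2 ℕ.*_) ≡n)))))
                       (*-zeroʳ (evens m))

1ₛ-homogeneous : Homogeneous 0 (coeff 1ₛ)
1ₛ-homogeneous m ≢0 = trans (coeff-1ₛ m) (trans (δ≡𝟙degree m) (𝟙-no (degree m ≟ 0) ≢0))

parts-homogeneous : ∀ {F f} → Represents F f → ∀ α → Homogeneous ∣ α ∣ (coeff (parts F α))
parts-homogeneous         F-f []                = 1ₛ-homogeneous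
parts-homogeneous {F} {f} F-f (pos (suc k) ∷ α) = ⋆-homogeneous
  (λ m ≢k → trans (F-f k m) (trans (cong (_* f m) (𝟙-no (degree m ≟ suc k) ≢k)) (*-zeroˡ (f m))))
  (parts-homogeneous F-f α)

-- Before filtering, each of the two compositions ranges over all sizes up to `d` on its own, so its
-- sum is `f` truncated to degrees at most `d`.
Σ-upToDegree : ∀ F C w {f} → Generates F C w f → ∀ d a →
  Σ[ α ← concatMap C (upTo (suc d)) ] (w α * coeff (parts F α) a) ≡ 𝟙 (degree a ℕ.<? suc d) * f a
Σ-upToDegree F C w {f} C-f d a = begin
  Σ[ α ← concatMap C (upTo (suc d)) ] (w α * coeff (parts F α) a)
    ≡⟨ Σ-concatMap (λ α → w α * coeff (parts F α) a) C (upTo (suc d)) ⟩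
  Σ[ n ← upTo (suc d) ] Σ[ α ← C n ] (w α * coeff (parts F α) a)
    ≡⟨ Σ-cong (upTo (suc d)) (λ n → C-f n a) ⟩
  Σ[ n ← upTo (suc d) ] (𝟙 (degree a ≟ n) * f a)
    ≡⟨ Σ-upTo-𝟙 (λ _ → f a) (degree a) (suc d) ⟩
  𝟙 (degree a ℕ.<? suc d) * f a ∎

-- Common form of the three identities: in each of them `f` is `h` and `g` is `e`, and only `F` and
-- the way in which `h` and `e` are generated differ.
module _
  (F : ℕ → Series) (A B : ℕ → List Composition) (w u : Composition → ℚ) {f g k : Monomial → ℚ}
  (F-k : Represents F k) (A-f : Generates F A w f) (B-g : Generates F B u g)
  (f⋆g : ∀ m → (f ⋆ dilated g) m ≡ e⁺ m)
  where

  private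
    X : Composition → Composition → Monomial → ℚ
    X α β = coeff (parts F α) ⋆ dilated (coeff (parts F β))

  X-homogeneous : ∀ α β → Homogeneous (size (α ¹ β ²)) (X α β)
  X-homogeneous α β m ≢size = ⋆-homogeneous (parts-homogeneous F-k α)
    (dilated-homogeneous (parts-homogeneous F-k β)) m
    (λ deg → ≢size (trans deg (cong₂ ℕ._+_ (sym (ℕ.*-identityˡ ∣ α ∣)) (sym (ℕ.+-identityʳ (2 ℕ.* ∣ β ∣))))))

  -- By homogeneity the two conditions can differ only where `X α β m` is 0.
  𝟙-size : ∀ α β d m → 𝟙 (size (α ¹ β ²) ≟ d) * X α β m ≡ 𝟙 (degree m ≟ d) * X α β m
  𝟙-size α β d m = split (degree m ≟ size (α ¹ β ²))
    where
    split : Dec (degree m ≡ size (α ¹ β ²)) →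
            𝟙 (size (α ¹ β ²) ≟ d) * X α β m ≡ 𝟙 (degree m ≟ d) * X α β m
    split (yes deg) = cong (λ n → 𝟙 (n ≟ d) * X α β m) (sym deg)
    split (no ≢size) = trans (cong (𝟙 (size (α ¹ β ²) ≟ d) *_) X≡0) (trans (*-zeroʳ (𝟙 (size (α ¹ β ²) ≟ d)))
      (sym (trans (cong (𝟙 (degree m ≟ d) *_) X≡0) (*-zeroʳ (𝟙 (degree m ≟ d))))))
      where
      X≡0 : X α β m ≡ 0ℚ
      X≡0 = X-homogeneous α β m ≢size

  module _ (d : ℕ) where

    private
      As Bs : List Composition
      As = concatMap A (upTo (suc d))
      Bs = concatMap B (upTo (suc d))

    bounded : ∀ {n} x → n ≤ d → 𝟙 (n ℕ.<? suc d) * x ≡ x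
    bounded {n} x n≤d = trans (cong (_* x) (𝟙-yes (n ℕ.<? suc d) (s≤s n≤d))) (*-identityˡ x)

    -- Both pieces of a monomial of degree `d` have degree at most `d`, and so has the root of the
    -- second if it is a square; if not, `evens` is 0. The truncations of `Σ-upToDegree` thus have
    -- no effect.
    Σ-product : ∀ m → degree m ≡ d →
      Σ[ α ← As ] Σ[ β ← Bs ] ((w α * u β) * X α β m) ≡ e⁺ m
    Σ-product m refl = begin
      Σ[ α ← As ] Σ[ β ← Bs ] ((w α * u β) * X α β m)
        ≡⟨ Σ-cong As (λ α → trans (Σ-cong Bs (λ β → distribute α β))
             (Σ-swap (λ β (a , b) → left α a * right β b) Bs (splittings m))) ⟩
      Σ[ α ← As ] Σ[ a , b ← splittings m ] Σ[ β ← Bs ] (left α a * right β b)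
        ≡⟨ Σ-swap (λ α (a , b) → Σ[ β ← Bs ] (left α a * right β b)) As (splittings m) ⟩
      Σ[ a , b ← splittings m ] Σ[ α ← As ] Σ[ β ← Bs ] (left α a * right β b)
        ≡⟨ Σ-cong (splittings m) (λ (a , b) → trans
             (Σ-*-Σ (λ α → left α a) (λ β → right β b) As Bs)
             (cong₂ _*_ (Σ-upToDegree F A w A-f d a) (trans
               (Σ-*ˡ (evens b) (λ β → u β * coeff (parts F β) (root 2 b)) Bs)
               (cong (evens b *_) (Σ-upToDegree F B u B-g d (root 2 b)))))) ⟩
      Σ[ a , b ← splittings m ] ((𝟙 (degree a ℕ.<? suc d) * f a) *
        (evens b * (𝟙 (degree (root 2 b) ℕ.<? suc d) * g (root 2 b))))
        ≡⟨ graded _ _ m (λ a b deg → cong₂ _*_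
             (bounded (f a) (subst (degree a ≤_) deg (ℕ.m≤m+n (degree a) (degree b))))
             (drop-bound b (subst (degree b ≤_) deg (ℕ.m≤n+m (degree b) (degree a))))) ⟩
      (f ⋆ dilated g) m
        ≡⟨ f⋆g m ⟩
      e⁺ m ∎
      where
      left : Composition → Monomial → ℚ
      left α a = w α * coeff (parts F α) a
      right : Composition → Monomial → ℚ
      right β b = evens b * (u β * coeff (parts F β) (root 2 b))
      distribute : ∀ α β → (w α * u β) * X α β m ≡ Σ[ a , b ← splittings m ] (left α a * right β b)
      distribute α β = trans
        (sym (Σ-*ˡ (w α * u β) (λ (a , b) → coeff (parts F α) a * dilated (coeff (parts F β)) b) (splittings m)))
        (Σ-cong (splittings m) (λ (a , b) →
          rearrange (w α) (u β) (coeff (parts F α) a) (evens b) (coeff (parts F β) (root 2 b))))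
        where
        rearrange : ∀ p q r s t → (p * q) * (r * (s * t)) ≡ (p * r) * (s * (q * t))
        rearrange = solve-∀ ℚ-ring
      drop-bound : ∀ b → degree b ≤ d →
        evens b * (𝟙 (degree (root 2 b) ℕ.<? suc d) * g (root 2 b)) ≡ dilated g b
      drop-bound b b≤d with evens≡0⊎degree-double b
      ... | inj₁ ≡0  = trans (cong (_* (𝟙 (degree (root 2 b) ℕ.<? suc d) * g (root 2 b))) ≡0)
        (trans (*-zeroˡ (𝟙 (degree (root 2 b) ℕ.<? suc d) * g (root 2 b)))
          (sym (trans (cong (_* g (root 2 b)) ≡0) (*-zeroˡ (g (root 2 b))))))
      ... | inj₂ deg = cong (evens b *_) (bounded (g (root 2 b))
        (ℕ.≤-trans (ℕ.m≤n*m (degree (root 2 b)) 2) (subst (_≤ d) deg b≤d)))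

    -- The coefficient `c` is a parameter so that it can appear as a sign or through `1/Z` rather
    -- than as a product of weights.
    E⁺-expansion : ∀ (c : Composition → Composition → ℚ) → (∀ α β → c α β ≡ w α * u β) →
      E⁺ d ≈ ∑ (pairsOfSize A B d) (λ (α , β) → c α β • F ⟦ α ¹ β ² ⟧)
    E⁺-expansion c c≡wu m = sym (begin
      Σ[ α , β ← pairsOfSize A B d ] (c α β * coeff (F ⟦ α ¹ β ² ⟧) m)
        ≡⟨ Σ-filter (λ (α , β) → size (α ¹ β ²) ≟ d)
             (λ (α , β) → c α β * coeff (F ⟦ α ¹ β ² ⟧) m) (cartesianProduct As Bs) ⟩
      Σ[ α , β ← cartesianProduct As Bs ] (𝟙 (size (α ¹ β ²) ≟ d) * (c α β * coeff (F ⟦ α ¹ β ² ⟧) m))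
        ≡⟨ Σ-× _,_ _ As Bs ⟩
      Σ[ α ← As ] Σ[ β ← Bs ] (𝟙 (size (α ¹ β ²) ≟ d) * (c α β * coeff (F ⟦ α ¹ β ² ⟧) m))
        ≡⟨ Σ-cong As (λ α → trans (Σ-cong Bs (term α))
             (Σ-*ˡ (𝟙 (degree m ≟ d)) (λ β → (w α * u β) * X α β m) Bs)) ⟩
      Σ[ α ← As ] (𝟙 (degree m ≟ d) * Σ[ β ← Bs ] ((w α * u β) * X α β m))
        ≡⟨ Σ-*ˡ (𝟙 (degree m ≟ d)) (λ α → Σ[ β ← Bs ] ((w α * u β) * X α β m)) As ⟩
      𝟙 (degree m ≟ d) * (Σ[ α ← As ] Σ[ β ← Bs ] ((w α * u β) * X α β m))
        ≡⟨ by-degree (degree m ≟ d) ⟩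
      𝟙 (degree m ≟ d) * e⁺ m
        ≡⟨ sym (coeff-E⁺ d m) ⟩
      coeff (E⁺ d) m ∎)
      where
      exchange : ∀ x y z → x * (y * z) ≡ y * (x * z)
      exchange = solve-∀ ℚ-ring
      term : ∀ α β → 𝟙 (size (α ¹ β ²) ≟ d) * (c α β * coeff (F ⟦ α ¹ β ² ⟧) m) ≡
             𝟙 (degree m ≟ d) * ((w α * u β) * X α β m)
      term α β = begin
        𝟙 (size (α ¹ β ²) ≟ d) * (c α β * coeff (F ⟦ α ¹ β ² ⟧) m)
          ≡⟨ cong₂ (λ q r → 𝟙 (size (α ¹ β ²) ≟ d) * (q * r)) (c≡wu α β) (coeff-⟦⟧ F α β m) ⟩
        𝟙 (size (α ¹ β ²) ≟ d) * ((w α * u β) * X α β m)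
          ≡⟨ exchange (𝟙 (size (α ¹ β ²) ≟ d)) (w α * u β) (X α β m) ⟩
        (w α * u β) * (𝟙 (size (α ¹ β ²) ≟ d) * X α β m)
          ≡⟨ cong ((w α * u β) *_) (𝟙-size α β d m) ⟩
        (w α * u β) * (𝟙 (degree m ≟ d) * X α β m)
          ≡⟨ exchange (w α * u β) (𝟙 (degree m ≟ d)) (X α β m) ⟩
        𝟙 (degree m ≟ d) * ((w α * u β) * X α β m) ∎
      by-degree : (deg? : Dec (degree m ≡ d)) →
        𝟙 deg? * (Σ[ α ← As ] Σ[ β ← Bs ] ((w α * u β) * X α β m)) ≡ 𝟙 deg? * e⁺ m
      by-degree (yes deg) = cong (1ℚ *_) (Σ-product m deg)
      by-degree (no _)    = trans
        (*-zeroˡ (Σ[ α ← As ] Σ[ β ← Bs ] ((w α * u β) * X α β m))) (sym (*-zeroˡ (e⁺ m)))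

-- The three identities

E-represents : Represents E e
E-represents d = coeff-E (suc d)

H-represents : Represents H h
H-represents d = coeff-H (suc d)

-- Signed sums of products of the `E d` generate `h`, and those of the `H d` generate `e`.
module InverseEH = Inverse (linear (- 1ℚ)) one refl refl e⋆h
module InverseHE = Inverse one (linear (- 1ℚ)) refl refl h⋆e
-- From D E = - P E, with `c` equal to 1, the inverse `h` of `e` is the sum weighted by 1/Z; from D
-- H = P H, with `c` equal to -1, `e` is the one with additional signs.
module DerivativeE = LogarithmicDerivative (linear (- 1ℚ)) one refl e⋆h 1ℚ (- 1ℚ) refl p⋆e
module DerivativeH = LogarithmicDerivative one (linear (- 1ℚ)) refl h⋆e (- 1ℚ) 1ℚ refl p⋆h

proposition25 : (d : ℕ) →
    (E⁺ d ≈ ∑ (PComE d) (λ (α , β) → -1^ ℓ α • E ⟦ α ¹ β ² ⟧)) ×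
    (E⁺ d ≈ ∑ (PComH d) (λ (α , β) → -1^ ℓ β • H ⟦ α ¹ β ² ⟧)) ×
    (E⁺ d ≈ ∑ (PComP d) (λ (α , β) → (-1^ ℓ β *ℚ (1/Z α *ℚ 1/Z β)) • P ⟦ α ¹ β ² ⟧))
proposition25 d =
  E⁺-expansion E compositions ([_] ∘ row) (weight (λ _ → - 1ℚ) 0) (λ _ → 1ℚ) E-represents
    (InverseEH.signed-compositions-generate E E-represents)
    (row-generates E (linear (- 1ℚ)) refl E-represents)
    h⋆dilated-e d (λ α β → -1^ ℓ α)
    (λ α β → sym (trans (*-identityʳ (weight (λ _ → - 1ℚ) 0 α)) (weight-sign 0 α))) ,
  E⁺-expansion H ([_] ∘ row) compositions (λ _ → 1ℚ) (weight (λ _ → - 1ℚ) 0) H-represents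
    (row-generates H one refl H-represents)
    (InverseHE.signed-compositions-generate H H-represents)
    h⋆dilated-e d (λ α β → -1^ ℓ β)
    (λ α β → sym (trans (*-identityˡ (weight (λ _ → - 1ℚ) 0 β)) (weight-sign 0 β))) ,
  E⁺-expansion P compositions compositions
    (weight (λ k → 1ℚ * recip k) 0) (weight (λ k → - 1ℚ * recip k) 0) coeff-P
    DerivativeE.compositions-generate
    DerivativeH.compositions-generate
    h⋆dilated-e d (λ α β → -1^ ℓ β * (1/Z α * 1/Z β)) Z-weights
  where
  rearrange : ∀ x y z → x * (y * z) ≡ y * (x * z)
  rearrange = solve-∀ ℚ-ring
  Z-weights : ∀ α β → -1^ ℓ β * (1/Z α * 1/Z β) ≡
              weight (λ k → 1ℚ * recip k) 0 α * weight (λ k → - 1ℚ * recip k) 0 β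
  Z-weights α β = begin
    -1^ ℓ β * (1/Z α * 1/Z β)
      ≡⟨ rearrange (-1^ ℓ β) (1/Z α) (1/Z β) ⟩
    1/Z α * (-1^ ℓ β * 1/Z β)
      ≡⟨ cong₂ (λ x y → x * (-1^ ℓ β * y)) (1/Z≡recip α) (1/Z≡recip β) ⟩
    recip (Z α) * (-1^ ℓ β * recip (Z β))
      ≡⟨ cong₂ _*_ (sym (weight-recip 0 α)) (sym (weight-signed-recip 0 β)) ⟩
    weight (λ k → 1ℚ * recip k) 0 α * weight (λ k → - 1ℚ * recip k) 0 β ∎
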